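{- For each integer $s\geq 2$, \[\lim_{t\to\infty}\sqrt[t]{A_{321}(K_{s,t}^\beta)}=2^s.\]
   Context: The comb $K_{s,t}$ has elements $e_{i,j}$, $1\le i\le s$, $1\le j\le t$, with partial order generated by the covers $e_{i,1}\lessdot e_{i+1,1}$ ($1\le i\le s-1$) and $e_{i,j}\lessdot e_{i,j+1}$ ($1\le j\le t-1$). $K^\beta_{s,t}$ is the labeled poset on $[st]$ obtained by giving $e_{i,j}$ the label $(i-1)t+j$. A linear extension is a permutation of $[st]$ in which $x$ precedes $y$ whenever $x<y$ in the poset; $A_{321}(P)$ is the number of linear extensions of $P$ avoiding the pattern $321$. -}

module Defs where

open import Level using (0ℓ)
open import Function.Base using (_on_)
open import Data.Fin.Base as Fin using (Fin; toℕ; combine; remQuot)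
import Data.Fin.Properties as Fin
open import Data.Integer.Base using (+_)
open import Data.List.Base using (List; []; _∷_; length; filter; allFin; cartesianProductWith)
open import Data.List.Membership.Propositional using (_∈_)
open import Data.List.Membership.Propositional.Properties using (∈-cartesianProductWith⁺; ∈-allFin)
open import Data.List.Relation.Unary.All using ([])
open import Data.List.Relation.Unary.AllPairs using ([]; _∷_)
open import Data.List.Relation.Unary.Any using (here)
import Data.List.Relation.Unary.Unique.Propositional as List
import Data.List.Relation.Unary.Unique.Propositional.Properties as ListUnique
open import Data.Nat.Base as ℕ using (ℕ; zero; suc; NonZero)
import Data.Nat.Properties as ℕ
open import Data.Product.Base using (∃; ∃₂; _×_; _,_; proj₁; proj₂; uncurry)
open import Data.Rational.Base as ℚ using (ℚ; 0ℚ; 1ℚ; _/_; 1/_; _⊓_; _⊔_; Positive)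
import Data.Rational.Properties as ℚ
open import Data.Sum.Base using (_⊎_; inj₁; inj₂)
open import Data.Vec.Base using (Vec; []; _∷_; lookup)
open import Data.Vec.Properties using (∷-injective)
open import Data.Vec.Relation.Unary.AllPairs using (allPairs?)
open import Data.Vec.Relation.Unary.Unique.Propositional using (Unique)
open import Relation.Binary.Construct.Closure.ReflexiveTransitive using (Star; ε; _◅_; _◅◅_)
import Relation.Binary.Construct.NonStrictToStrict as NonStrictToStrict
open import Relation.Binary.Core using (Rel)
open import Relation.Binary.Definitions using (Decidable)
open import Relation.Binary.PropositionalEquality
  using (_≡_; refl; sym; trans; cong; subst; subst₂; isEquivalence)
open import Relation.Binary.Structures using (IsDecPartialOrder)
open import Relation.Nullary using (¬_; yes; no; contradiction)
open import Relation.Nullary.Decidable using (map′; _×-dec_; _⊎-dec_; _→-dec_; ¬?)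
import Relation.Unary as Unary

open import Algebra.Definitions.RawSemiring ℚ.+-*-rawSemiring public
  using () renaming (_^_ to _^ℚ_)

------------------------------------------------------------------------

-- The label set [n] is Fin n, so every label is shifted down by one.

record LabelledPoset (n : ℕ) : Set₁ where
  field
    _≤_               : Rel (Fin n) 0ℓ
    isDecPartialOrder : IsDecPartialOrder _≡_ _≤_

  open IsDecPartialOrder isDecPartialOrder public using (_≤?_)
  open NonStrictToStrict _≡_ _≤_ public using (_<_)

  _<?_ : Decidable _<_
  _<?_ = NonStrictToStrict.<-decidable _≡_ _≤_ Fin._≟_ _≤?_

-- One-line notation: the word w sends position k to lookup w k.
Word : ℕ → ℕ → Set
Word n m = Vec (Fin n) m

IsPermutation : ∀ {n} → Word n n → Set
IsPermutation w = Unique w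

Precedes : ∀ {n m} → Word n m → Fin n → Fin n → Set
Precedes w x y = ∃₂ λ k l → k Fin.< l × lookup w k ≡ x × lookup w l ≡ y

IsLinearExtension : ∀ {n} → LabelledPoset n → Word n n → Set
IsLinearExtension P w = IsPermutation w × (∀ x y → x < y → Precedes w x y)
  where open LabelledPoset P

Contains321 : ∀ {n m} → Word n m → Set
Contains321 w = ∃ λ i → ∃ λ j → ∃ λ k →
  i Fin.< j × j Fin.< k × lookup w j Fin.< lookup w i × lookup w k Fin.< lookup w j

Avoids321 : ∀ {n m} → Word n m → Set
Avoids321 w = ¬ Contains321 w

isPermutation? : ∀ {n} → Unary.Decidable (IsPermutation {n})
isPermutation? = allPairs? (λ x y → ¬? (x Fin.≟ y))

precedes? : ∀ {n m} (w : Word n m) → Decidable (Precedes w)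
precedes? w x y = Fin.any? λ k → Fin.any? λ l →
  k Fin.<? l ×-dec lookup w k Fin.≟ x ×-dec lookup w l Fin.≟ y

isLinearExtension? : ∀ {n} (P : LabelledPoset n) → Unary.Decidable (IsLinearExtension P)
isLinearExtension? P w = isPermutation? w ×-dec
  Fin.all? λ x → Fin.all? λ y → (x <? y) →-dec precedes? w x y
  where open LabelledPoset P

avoids321? : ∀ {n m} → Unary.Decidable (Avoids321 {n} {m})
avoids321? w = ¬? (Fin.any? λ i → Fin.any? λ j → Fin.any? λ k →
  i Fin.<? j ×-dec j Fin.<? k ×-dec
  lookup w j Fin.<? lookup w i ×-dec lookup w k Fin.<? lookup w j)

words : ∀ n m → List (Word n m)
words n zero    = [] ∷ []
words n (suc m) = cartesianProductWith _∷_ (allFin n) (words n m)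

words-complete : ∀ {n m} (w : Word n m) → w ∈ words n m
words-complete []      = here refl
words-complete (x ∷ w) = ∈-cartesianProductWith⁺ _∷_ (∈-allFin x) (words-complete w)

words-unique : ∀ n m → List.Unique (words n m)
words-unique n zero    = [] ∷ []
words-unique n (suc m) = ListUnique.cartesianProductWith⁺ _∷_ ∷-injective
  (ListUnique.allFin⁺ n) (words-unique n m)

A₃₂₁ : ∀ {n} → LabelledPoset n → ℕ
A₃₂₁ {n} P = length (filter (λ w → isLinearExtension? P w ×-dec avoids321? w) (words n n))

------------------------------------------------------------------------

-- The pair (i , j), counted from 0, stands for e_{i+1,j+1}.
module _ {s t : ℕ} where

  infix 4 _⋖_

  data _⋖_ : Rel (Fin s × Fin t) 0ℓ where
    spine : ∀ {i i′ j} → toℕ j ≡ 0 → toℕ i′ ≡ suc (toℕ i) → (i , j) ⋖ (i′ , j)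
    tooth : ∀ {i j j′} → toℕ j′ ≡ suc (toℕ j) → (i , j) ⋖ (i , j′)

  Comb : Rel (Fin s × Fin t) 0ℓ
  Comb = Star _⋖_

  -- combine i j has value i * t + j, which is one less than the label
  -- (i+1 − 1) t + (j+1) of e_{i+1,j+1}.
  label : Fin s × Fin t → Fin (s ℕ.* t)
  label = uncurry combine

  unlabel : Fin (s ℕ.* t) → Fin s × Fin t
  unlabel = remQuot t

  private
    Explicit : Rel (Fin s × Fin t) 0ℓ
    Explicit (i , j) (i′ , j′) = (i ≡ i′ × j Fin.≤ j′) ⊎ (i Fin.≤ i′ × toℕ j ≡ 0)

    explicit? : Decidable Explicit
    explicit? (i , j) (i′ , j′) =
      (i Fin.≟ i′ ×-dec j Fin.≤? j′) ⊎-dec (i Fin.≤? i′ ×-dec toℕ j ℕ.≟ 0)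

    toExplicit : ∀ {a b} → Comb a b → Explicit a b
    toExplicit ε = inj₁ (refl , ℕ.≤-refl)
    toExplicit (spine j≡0 i′≡1+i ◅ r) with toExplicit r
    ... | inj₁ (refl , _) = inj₂ (ℕ.≤-trans (ℕ.n≤1+n _) (ℕ.≤-reflexive (sym i′≡1+i)) , j≡0)
    ... | inj₂ (i′≤k , _) = inj₂ (ℕ.≤-trans (ℕ.n≤1+n _) (subst (ℕ._≤ _) i′≡1+i i′≤k) , j≡0)
    toExplicit (tooth j′≡1+j ◅ r) with toExplicit r
    ... | inj₁ (i≡k , j′≤l) = inj₁ (i≡k , ℕ.≤-trans (ℕ.n≤1+n _) (subst (ℕ._≤ _) j′≡1+j j′≤l))
    ... | inj₂ (_ , j′≡0)   = contradiction (trans (sym j′≡1+j) j′≡0) λ ()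

    climb : ∀ {n} {R : Rel (Fin n) 0ℓ} → (∀ {j j′} → toℕ j′ ≡ suc (toℕ j) → R j j′) →
            ∀ d {j j′} → toℕ j′ ≡ d ℕ.+ toℕ j → Star R j j′
    climb step zero    eq = subst (Star _ _) (Fin.toℕ-injective (sym eq)) ε
    climb step (suc d) {j} {j′} eq = step k≡1+j ◅ climb step d
        (trans eq (trans (sym (ℕ.+-suc d (toℕ j))) (cong (d ℕ.+_) (sym k≡1+j))))
      where
      1+j<n = ℕ.≤-<-trans (subst (suc (toℕ j) ℕ.≤_) (sym eq) (ℕ.s≤s (ℕ.m≤n+m _ d))) (Fin.toℕ<n j′)
      k≡1+j = Fin.toℕ-fromℕ< 1+j<n

    climb≤ : ∀ {n} {R : Rel (Fin n) 0ℓ} → (∀ {j j′} → toℕ j′ ≡ suc (toℕ j) → R j j′) →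
             ∀ {j j′} → j Fin.≤ j′ → Star R j j′
    climb≤ step {j} {j′} j≤j′ = climb step (toℕ j′ ℕ.∸ toℕ j) (sym (ℕ.m∸n+n≡m j≤j′))

    gmapTooth : ∀ {i j j′} → Star (λ k l → (i , k) ⋖ (i , l)) j j′ → Comb (i , j) (i , j′)
    gmapTooth ε       = ε
    gmapTooth (c ◅ r) = c ◅ gmapTooth r

    gmapSpine : ∀ {i i′ j} → Star (λ k l → (k , j) ⋖ (l , j)) i i′ → Comb (i , j) (i′ , j)
    gmapSpine ε       = ε
    gmapSpine (c ◅ r) = c ◅ gmapSpine r

    fromExplicit : ∀ {a b} → Explicit a b → Comb a b
    fromExplicit (inj₁ (refl , j≤j′)) = gmapTooth (climb≤ tooth j≤j′)
    fromExplicit (inj₂ (i≤i′ , j≡0)) =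
      gmapSpine (climb≤ (spine j≡0) i≤i′) ◅◅
      gmapTooth (climb≤ tooth (subst (ℕ._≤ _) (sym j≡0) ℕ.z≤n))

  comb? : Decidable Comb
  comb? a b = map′ fromExplicit toExplicit (explicit? a b)

  ⋖⇒label< : ∀ {a b} → a ⋖ b → label a Fin.< label b
  ⋖⇒label< {_ , j} (spine _ i′≡1+i) = Fin.combine-monoˡ-< j j (ℕ.≤-reflexive (sym i′≡1+i))
  ⋖⇒label< (tooth {i} {j} {j′} j′≡1+j) =
    subst₂ ℕ._<_ (sym (Fin.toℕ-combine i j)) (sym (Fin.toℕ-combine i j′))
      (ℕ.+-monoʳ-< (t ℕ.* toℕ i) (ℕ.≤-reflexive (sym j′≡1+j)))

  Comb⇒label≤ : ∀ {a b} → Comb a b → label a Fin.≤ label b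
  Comb⇒label≤ ε       = ℕ.≤-refl
  Comb⇒label≤ (c ◅ r) = ℕ.≤-trans (ℕ.<⇒≤ (⋖⇒label< c)) (Comb⇒label≤ r)

Kᵝ : ∀ s t → LabelledPoset (s ℕ.* t)
Kᵝ s t = record
  { _≤_ = Comb {s} {t} on unlabel {s} {t}
  ; isDecPartialOrder = record
    { isPartialOrder = record
      { isPreorder = record
        { isEquivalence = isEquivalence
        ; reflexive     = λ { refl → ε }
        ; trans         = _◅◅_
        }
      ; antisym = λ {x} {y} x≤y y≤x → subst₂ _≡_
          (Fin.combine-remQuot {s} t x) (Fin.combine-remQuot {s} t y)
          (Fin.toℕ-injective (ℕ.≤-antisym (Comb⇒label≤ x≤y) (Comb⇒label≤ y≤x)))
      }
    ; _≟_  = Fin._≟_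
    ; _≤?_ = λ x y → comb? (unlabel {s} {t} x) (unlabel {s} {t} y)
    }
  }

------------------------------------------------------------------------

-- Two-sided Dedekind cuts, which need no choice or excluded middle.
record ℝ : Set₁ where
  field
    L U         : ℚ → Set
    L-inhabited : ∃ L
    U-inhabited : ∃ U
    L-lower     : ∀ {p q} → p ℚ.< q → L q → L p
    U-upper     : ∀ {p q} → p ℚ.< q → U p → U q
    L-open      : ∀ {p} → L p → ∃ λ q → p ℚ.< q × L q
    U-open      : ∀ {q} → U q → ∃ λ p → p ℚ.< q × U p
    disjoint    : ∀ {q} → L q → ¬ U q
    located     : ∀ {p q} → p ℚ.< q → L p ⊎ U q

open ℝ

infix 4 _<ᴿ_
_<ᴿ_ : ℝ → ℝ → Set
x <ᴿ y = ∃ λ q → U x q × L y q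

fromℚ : ℚ → ℝ
fromℚ r = record
  { L           = ℚ._< r
  ; U           = r ℚ.<_
  ; L-inhabited = r ℚ.- 1ℚ , subst (r ℚ.- 1ℚ ℚ.<_) (ℚ.+-identityʳ r) (ℚ.+-monoʳ-< r (ℚ.negative⁻¹ (ℚ.- 1ℚ)))
  ; U-inhabited = r ℚ.+ 1ℚ , subst (ℚ._< r ℚ.+ 1ℚ) (ℚ.+-identityʳ r) (ℚ.+-monoʳ-< r (ℚ.positive⁻¹ 1ℚ))
  ; L-lower     = ℚ.<-trans
  ; U-upper     = λ p<q r<p → ℚ.<-trans r<p p<q
  ; L-open      = λ p<r → let m , p<m , m<r = ℚ.<-dense p<r in m , p<m , m<r
  ; U-open      = λ r<q → let m , r<m , m<q = ℚ.<-dense r<q in m , m<q , r<m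
  ; disjoint    = ℚ.<-asym
  ; located     = located′
  }
  where
  located′ : ∀ {p q} → p ℚ.< q → p ℚ.< r ⊎ r ℚ.< q
  located′ {p} p<q with p ℚ.<? r
  ... | yes p<r = inj₁ p<r
  ... | no  p≮r = inj₂ (ℚ.≤-<-trans (ℚ.≮⇒≥ p≮r) p<q)

fromℕ : ℕ → ℚ
fromℕ n = + n / 1

private
  +-cancel : ∀ q δ → (q ℚ.+ δ) ℚ.- δ ≡ q
  +-cancel q δ = trans (ℚ.+-assoc q δ (ℚ.- δ))
    (trans (cong (q ℚ.+_) (ℚ.+-inverseʳ δ)) (ℚ.+-identityʳ q))

  +-cancel′ : ∀ q δ → (q ℚ.- δ) ℚ.+ δ ≡ q
  +-cancel′ q δ = trans (ℚ.+-assoc q (ℚ.- δ) δ)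
    (trans (cong (q ℚ.+_) (ℚ.+-inverseˡ δ)) (ℚ.+-identityʳ q))

-- Translation of a real by a rational.
infixl 6 _⊕_
_⊕_ : ℝ → ℚ → ℝ
x ⊕ δ = record
  { L           = λ q → L x (q ℚ.- δ)
  ; U           = λ q → U x (q ℚ.- δ)
  ; L-inhabited = let q , l = L-inhabited x in q ℚ.+ δ , subst (L x) (sym (+-cancel q δ)) l
  ; U-inhabited = let q , u = U-inhabited x in q ℚ.+ δ , subst (U x) (sym (+-cancel q δ)) u
  ; L-lower     = λ p<q → L-lower x (shift p<q)
  ; U-upper     = λ p<q → U-upper x (shift p<q)
  ; L-open      = λ {p} l → let q , p-δ<q , l′ = L-open x l in
      q ℚ.+ δ , subst (ℚ._< q ℚ.+ δ) (+-cancel′ p δ) (ℚ.+-monoˡ-< δ p-δ<q) ,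
      subst (L x) (sym (+-cancel q δ)) l′
  ; U-open      = λ {q} u → let p , p<q-δ , u′ = U-open x u in
      p ℚ.+ δ , subst (p ℚ.+ δ ℚ.<_) (+-cancel′ q δ) (ℚ.+-monoˡ-< δ p<q-δ) ,
      subst (U x) (sym (+-cancel p δ)) u′
  ; disjoint    = disjoint x
  ; located     = λ p<q → located x (shift p<q)
  }
  where
  shift : ∀ {p q} → p ℚ.< q → p ℚ.- δ ℚ.< q ℚ.- δ
  shift = ℚ.+-monoˡ-< (ℚ.- δ)

-- Indices are positive, as a 0-th root is meaningless; rational tolerances
-- suffice, being cofinal among the positive reals.
infix 4 _⟶_
_⟶_ : ((t : ℕ) → .{{NonZero t}} → ℝ) → ℝ → Set
x ⟶ ℓ = ∀ δ → 0ℚ ℚ.< δ → ∃ λ N → ∀ t → .{{_ : NonZero t}} → N ℕ.≤ t →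
  ℓ ⊕ (ℚ.- δ) <ᴿ x t × x t <ᴿ ℓ ⊕ δ

------------------------------------------------------------------------

private
  ^-pos : ∀ {q} t → 0ℚ ℚ.< q → 0ℚ ℚ.< q ^ℚ t
  ^-pos zero    0<q = ℚ.positive⁻¹ 1ℚ
  ^-pos {q} (suc t) 0<q = subst (ℚ._< q ℚ.* q ^ℚ t) (ℚ.*-zeroʳ q)
    (ℚ.*-monoʳ-<-pos q {{ℚ.positive 0<q}} (^-pos t 0<q))

  ^-nonNeg : ∀ {q} t → 0ℚ ℚ.≤ q → 0ℚ ℚ.≤ q ^ℚ t
  ^-nonNeg zero    0≤q = ℚ.<⇒≤ (ℚ.positive⁻¹ 1ℚ)
  ^-nonNeg {q} (suc t) 0≤q = subst (ℚ._≤ q ℚ.* q ^ℚ t) (ℚ.*-zeroʳ q)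
    (ℚ.*-monoˡ-≤-nonNeg q {{ℚ.nonNegative 0≤q}} (^-nonNeg t 0≤q))

  ^-mono-≤ : ∀ {p q} t → 0ℚ ℚ.≤ p → p ℚ.≤ q → p ^ℚ t ℚ.≤ q ^ℚ t
  ^-mono-≤ zero    0≤p p≤q = ℚ.≤-refl
  ^-mono-≤ {p} {q} (suc t) 0≤p p≤q = ℚ.≤-trans
    (ℚ.*-monoʳ-≤-nonNeg (p ^ℚ t) {{ℚ.nonNegative (^-nonNeg t 0≤p)}} p≤q)
    (ℚ.*-monoˡ-≤-nonNeg q {{ℚ.nonNegative (ℚ.≤-trans 0≤p p≤q)}} (^-mono-≤ t 0≤p p≤q))

  ^-mono-< : ∀ {p q} t → .{{NonZero t}} → 0ℚ ℚ.≤ p → p ℚ.< q → p ^ℚ t ℚ.< q ^ℚ t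
  ^-mono-< {p} {q} (suc t) 0≤p p<q = ℚ.≤-<-trans
    (ℚ.*-monoˡ-≤-nonNeg p {{ℚ.nonNegative 0≤p}} (^-mono-≤ t 0≤p (ℚ.<⇒≤ p<q)))
    (ℚ.*-monoˡ-<-pos (q ^ℚ t) {{ℚ.positive (^-pos t (ℚ.≤-<-trans 0≤p p<q))}} p<q)

  divide : ∀ m y → .{{_ : Positive y}} → ∃ λ u → u ℚ.* y ≡ m
  divide m y = m ℚ.* 1/ y , trans (ℚ.*-assoc m (1/ y) y)
      (trans (cong (m ℚ.*_) (ℚ.*-inverseˡ y)) (ℚ.*-identityʳ m))
    where instance _ = ℚ.pos⇒nonZero y

  cancel-<ʳ : ∀ y {p q} → 0ℚ ℚ.< y → p ℚ.* y ℚ.< q ℚ.* y → p ℚ.< q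
  cancel-<ʳ y 0<y = ℚ.*-cancelʳ-<-nonNeg y {{ℚ.nonNegative (ℚ.<⇒≤ 0<y)}}

  scaleUp : ∀ {x y a} → 0ℚ ℚ.< y → x ℚ.* y ℚ.< a → ∃ λ u → x ℚ.< u × u ℚ.* y ℚ.< a
  scaleUp {x} {y} {a} 0<y xy<a =
    let m , xy<m , m<a = ℚ.<-dense xy<a
        u , uy≡m = divide m y {{ℚ.positive 0<y}}
    in u , cancel-<ʳ y 0<y (subst (x ℚ.* y ℚ.<_) (sym uy≡m) xy<m) ,
       subst (ℚ._< a) (sym uy≡m) m<a

  scaleUp₀ : ∀ {x y a} → 0ℚ ℚ.≤ y → x ℚ.* y ℚ.< a → ∃ λ u → x ℚ.< u × u ℚ.* y ℚ.< a
  scaleUp₀ {x} {y} {a} 0≤y xy<a with 0ℚ ℚ.<? y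
  ... | yes 0<y = scaleUp 0<y xy<a
  ... | no  0≮y with refl ← ℚ.≤-antisym 0≤y (ℚ.≮⇒≥ 0≮y) =
    proj₁ (U-inhabited (fromℚ x)) , proj₂ (U-inhabited (fromℚ x)) ,
    subst (ℚ._< a) (trans (ℚ.*-zeroʳ x) (sym (ℚ.*-zeroʳ (x ℚ.+ 1ℚ)))) xy<a

  scaleDown : ∀ {x y a} → 0ℚ ℚ.< x → 0ℚ ℚ.< y → a ℚ.< x ℚ.* y →
              ∃ λ u → 0ℚ ℚ.< u × u ℚ.< x × a ℚ.< u ℚ.* y
  scaleDown {x} {y} {a} 0<x 0<y a<xy =
    let m , b<m , m<xy = ℚ.<-dense b<xy
        u , uy≡m = divide m y {{ℚ.positive 0<y}}
    in u ,
       cancel-<ʳ y 0<y (subst₂ ℚ._<_ (sym (ℚ.*-zeroˡ y)) (sym uy≡m) (ℚ.≤-<-trans (ℚ.p≤p⊔q 0ℚ a) b<m)) ,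
       cancel-<ʳ y 0<y (subst (ℚ._< x ℚ.* y) (sym uy≡m) m<xy) ,
       subst (a ℚ.<_) (sym uy≡m) (ℚ.≤-<-trans (ℚ.p≤q⊔p 0ℚ a) b<m)
    where
    0<xy = subst (ℚ._< x ℚ.* y) (ℚ.*-zeroˡ y) (ℚ.*-monoˡ-<-pos y {{ℚ.positive 0<y}} 0<x)
    b<xy : 0ℚ ⊔ a ℚ.< x ℚ.* y
    b<xy with ℚ.⊔-sel 0ℚ a
    ... | inj₁ eq = subst (ℚ._< x ℚ.* y) (sym eq) 0<xy
    ... | inj₂ eq = subst (ℚ._< x ℚ.* y) (sym eq) a<xy

  ⊓-glb-< : ∀ {p q r} → p ℚ.< q → p ℚ.< r → p ℚ.< q ⊓ r
  ⊓-glb-< {p} {q} {r} p<q p<r with ℚ.⊓-sel q r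
  ... | inj₁ eq = subst (p ℚ.<_) (sym eq) p<q
  ... | inj₂ eq = subst (p ℚ.<_) (sym eq) p<r

  ⊔-lub-< : ∀ {p q r} → q ℚ.< p → r ℚ.< p → q ⊔ r ℚ.< p
  ⊔-lub-< {p} {q} {r} q<p r<p with ℚ.⊔-sel q r
  ... | inj₁ eq = subst (ℚ._< p) (sym eq) q<p
  ... | inj₂ eq = subst (ℚ._< p) (sym eq) r<p

  ^-openUp : ∀ {q a} t → 0ℚ ℚ.≤ q → q ^ℚ t ℚ.< a → ∃ λ r → q ℚ.< r × r ^ℚ t ℚ.< a
  ^-openUp {q} zero    0≤q lt = let r , q<r = U-inhabited (fromℚ q) in r , q<r , lt
  ^-openUp {q} {a} (suc t) 0≤q lt =
    let u , q<u , uqᵗ<a = scaleUp₀ (^-nonNeg t 0≤q) lt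
        0<u = ℚ.≤-<-trans 0≤q q<u
        v , qᵗ<v , vu<a = scaleUp 0<u (subst (ℚ._< a) (ℚ.*-comm u (q ^ℚ t)) uqᵗ<a)
        w , q<w , wᵗ<v = ^-openUp t 0≤q qᵗ<v
        r = u ⊓ w
        q<r = ⊓-glb-< q<u q<w
        0≤r = ℚ.<⇒≤ (ℚ.≤-<-trans 0≤q q<r)
        rᵗ≤v = ℚ.≤-trans (^-mono-≤ t 0≤r (ℚ.p⊓q≤q u w)) (ℚ.<⇒≤ wᵗ<v)
    in r , q<r , ℚ.≤-<-trans
         (ℚ.≤-trans
           (ℚ.*-monoʳ-≤-nonNeg (r ^ℚ t) {{ℚ.nonNegative (^-nonNeg t 0≤r)}} (ℚ.p⊓q≤p u w))
           (ℚ.*-monoˡ-≤-nonNeg u {{ℚ.nonNegative (ℚ.<⇒≤ 0<u)}} rᵗ≤v))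
         (subst (ℚ._< a) (ℚ.*-comm v u) vu<a)

  ^-openDown : ∀ {q a} t → 0ℚ ℚ.< q → a ℚ.< q ^ℚ t →
               ∃ λ r → 0ℚ ℚ.< r × r ℚ.< q × a ℚ.< r ^ℚ t
  ^-openDown zero    0<q lt = let m , 0<m , m<q = ℚ.<-dense 0<q in m , 0<m , m<q , lt
  ^-openDown {q} {a} (suc t) 0<q lt =
    let u , 0<u , u<q , a<uqᵗ = scaleDown 0<q (^-pos t 0<q) lt
        v , 0<v , v<qᵗ , a<vu =
          scaleDown (^-pos t 0<q) 0<u (subst (a ℚ.<_) (ℚ.*-comm u (q ^ℚ t)) a<uqᵗ)
        w , 0<w , w<q , v<wᵗ = ^-openDown t 0<q v<qᵗ
        r = u ⊔ w
        0<r = ℚ.<-≤-trans 0<u (ℚ.p≤p⊔q u w)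
        v≤rᵗ = ℚ.≤-trans (ℚ.<⇒≤ v<wᵗ) (^-mono-≤ t (ℚ.<⇒≤ 0<w) (ℚ.p≤q⊔p u w))
    in r , 0<r , ⊔-lub-< u<q w<q , ℚ.<-≤-trans
         (subst (a ℚ.<_) (ℚ.*-comm v u) a<vu)
         (ℚ.≤-trans
           (ℚ.*-monoˡ-≤-nonNeg u {{ℚ.nonNegative (ℚ.<⇒≤ 0<u)}} v≤rᵗ)
           (ℚ.*-monoʳ-≤-nonNeg (r ^ℚ t) {{ℚ.nonNegative (^-nonNeg t (ℚ.<⇒≤ 0<r))}} (ℚ.p≤p⊔q u w)))

  1≤^ : ∀ {q} t → 1ℚ ℚ.≤ q → 1ℚ ℚ.≤ q ^ℚ t
  1≤^ zero    1≤q = ℚ.≤-refl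
  1≤^ {q} (suc t) 1≤q = ℚ.≤-trans 1≤q (subst (ℚ._≤ q ℚ.* q ^ℚ t) (ℚ.*-identityʳ q)
    (ℚ.*-monoˡ-≤-nonNeg q {{ℚ.nonNegative (ℚ.≤-trans (ℚ.<⇒≤ (ℚ.positive⁻¹ 1ℚ)) 1≤q)}} (1≤^ t 1≤q)))

  ≤^ : ∀ {q} t → .{{NonZero t}} → 1ℚ ℚ.≤ q → q ℚ.≤ q ^ℚ t
  ≤^ {q} (suc t) 1≤q = subst (ℚ._≤ q ℚ.* q ^ℚ t) (ℚ.*-identityʳ q)
    (ℚ.*-monoˡ-≤-nonNeg q {{ℚ.nonNegative (ℚ.≤-trans (ℚ.<⇒≤ (ℚ.positive⁻¹ 1ℚ)) 1≤q)}} (1≤^ t 1≤q))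

  0≤fromℕ : ∀ n → 0ℚ ℚ.≤ fromℕ n
  0≤fromℕ n = ℚ.nonNegative⁻¹ (fromℕ n) {{ℚ.normalize-nonNeg n 1}}

-- The cut of ᵗ√a: a rational q lies below it iff q < 0 or qᵗ < a, and above
-- it iff q > 0 and a < qᵗ.  The sign conditions matter when t is even.
root : (t : ℕ) → .{{NonZero t}} → ℕ → ℝ
root t a = record
  { L           = Below
  ; U           = Above
  ; L-inhabited = ℚ.- 1ℚ , inj₁ (ℚ.negative⁻¹ (ℚ.- 1ℚ))
  ; U-inhabited = fromℕ a ℚ.+ 1ℚ , 0<a+1 ,
      ℚ.<-≤-trans (proj₂ (U-inhabited (fromℚ (fromℕ a)))) (≤^ t 1≤a+1)
  ; L-lower     = lower
  ; U-upper     = λ p<q (0<p , a<pᵗ) →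
      ℚ.<-trans 0<p p<q , ℚ.<-trans a<pᵗ (^-mono-< t (ℚ.<⇒≤ 0<p) p<q)
  ; L-open      = λ {p} → openL {p}
  ; U-open      = λ (0<q , a<qᵗ) →
      let r , 0<r , r<q , a<rᵗ = ^-openDown t 0<q a<qᵗ in r , r<q , 0<r , a<rᵗ
  ; disjoint    = λ { (inj₁ q<0)  (0<q , _)  → ℚ.<-asym q<0 0<q
                    ; (inj₂ qᵗ<a) (_ , a<qᵗ) → ℚ.<-asym qᵗ<a a<qᵗ }
  ; located     = loc
  }
  where
  Below Above : ℚ → Set
  Below q = q ℚ.< 0ℚ ⊎ q ^ℚ t ℚ.< fromℕ a
  Above q = 0ℚ ℚ.< q × fromℕ a ℚ.< q ^ℚ t

  1≤a+1 : 1ℚ ℚ.≤ fromℕ a ℚ.+ 1ℚ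
  1≤a+1 = subst (ℚ._≤ fromℕ a ℚ.+ 1ℚ) (ℚ.+-identityˡ 1ℚ) (ℚ.+-monoˡ-≤ 1ℚ (0≤fromℕ a))

  0<a+1 : 0ℚ ℚ.< fromℕ a ℚ.+ 1ℚ
  0<a+1 = ℚ.<-≤-trans (ℚ.positive⁻¹ 1ℚ) 1≤a+1

  lower : ∀ {p q} → p ℚ.< q → Below q → Below p
  lower p<q (inj₁ q<0) = inj₁ (ℚ.<-trans p<q q<0)
  lower {p} p<q (inj₂ qᵗ<a) with p ℚ.<? 0ℚ
  ... | yes p<0 = inj₁ p<0
  ... | no  p≮0 = inj₂ (ℚ.<-trans (^-mono-< t (ℚ.≮⇒≥ p≮0) p<q) qᵗ<a)

  openL : ∀ {p} → Below p → ∃ λ q → p ℚ.< q × Below q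
  openL {p} b with p ℚ.<? 0ℚ
  ... | yes p<0 = let m , p<m , m<0 = ℚ.<-dense p<0 in m , p<m , inj₁ m<0
  openL (inj₁ p<0)  | no p≮0 = contradiction p<0 p≮0
  openL (inj₂ pᵗ<a) | no p≮0 =
    let r , p<r , rᵗ<a = ^-openUp t (ℚ.≮⇒≥ p≮0) pᵗ<a in r , p<r , inj₂ rᵗ<a

  loc : ∀ {p q} → p ℚ.< q → Below p ⊎ Above q
  loc {p} {q} p<q with p ℚ.<? 0ℚ | p ^ℚ t ℚ.<? fromℕ a
  ... | yes p<0 | _         = inj₁ (inj₁ p<0)
  ... | no  p≮0 | yes pᵗ<a  = inj₁ (inj₂ pᵗ<a)
  ... | no  p≮0 | no  pᵗ≮a  = inj₂ (ℚ.≤-<-trans (ℚ.≮⇒≥ p≮0) p<q ,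
    ℚ.≤-<-trans (ℚ.≮⇒≥ pᵗ≮a) (^-mono-< t (ℚ.≮⇒≥ p≮0) p<q))

{-# OPTIONS --safe #-}

-- Up to factors polynomial in t, the number A of extensions is 2 ^ (s t).
--
-- Upper bound.  The left-to-right maxima of w in a given tooth form an initial segment of it:
-- what exceeds and precedes an element of the tooth comes from a later tooth.  So w determines
-- s thresholds in [0, t], and one bit per position marks the maxima; a 321-avoiding w is
-- determined by these data, hence A ≤ (t + 1) ^ s · 2 ^ (s t).
--
-- Lower bound.  Cut each tooth into two halves of about t / 2 elements and cut the word into s
-- segments.  Segment k is an arbitrary shuffle of the first half of tooth k + 1 (sequence U)
-- with the second half of tooth k − 1 (sequence L), where the missing partners are replaced by
-- the first half of tooth 0 in segment 0 and the second half of the last tooth in the last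
-- segment.  The U's of all segments together increase, and so do the L's, hence 321 is avoided.
-- With m = ⌊(t − 1) / 2⌋ there are at least C(2m, m) ≥ 4 ^ m / (2m + 1) shuffles per segment.

module Submission where

open import Algebra.Bundles using (CommutativeRing)
import Algebra.Properties.CommutativeSemiring.Exp as Exp
import Algebra.Properties.Group as Group
open import Data.Bool.Base using (Bool; true; false; if_then_else_)
open import Data.Empty using (⊥)
open import Data.Fin.Base as Fin
  using (Fin; zero; suc; toℕ; fromℕ<; combine; remQuot; splitAt; punchOut; funToFin; finToFun)
import Data.Fin.Properties as Fin
import Data.Integer.Base as ℤ
import Data.Integer.Properties as ℤ
open import Data.List.Base as List using (List; []; _∷_; length; filter; allFin)
open import Data.List.Membership.Propositional using (_∈_)
open import Data.List.Membership.Propositional.Properties using (∈-lookup; ∈-filter⁺; ∈-filter⁻)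
open import Data.List.Properties using (length-tabulate)
open import Data.List.Relation.Binary.Permutation.Propositional using (↭-sym; ↭⇒↭ₛ)
open import Data.List.Relation.Binary.Permutation.Propositional.Properties using (↭-length)
import Data.List.Relation.Binary.Permutation.Setoid.Properties as Permutationₛ
open import Data.List.Relation.Unary.All as All using (All; []; _∷_)
open import Data.List.Relation.Unary.AllPairs as AllPairs using (AllPairs; []; _∷_)
import Data.List.Relation.Unary.Any as Any
open import Data.List.Relation.Unary.Any.Properties using (lookup-index)
open import Data.List.Relation.Unary.Linked.Properties using (Linked⇒AllPairs)
import Data.List.Relation.Unary.Unique.Propositional as List
import Data.List.Relation.Unary.Unique.Propositional.Properties as List
import Data.List.Sort as Sort
open import Data.Nat.Base
open import Data.Nat.Properties
open import Data.Nat.Tactic.RingSolver using (solve-∀)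
open import Data.Product.Base using (∃; ∃₂; _×_; _,_; proj₁; proj₂; uncurry)
open import Data.Rational.Base as ℚ using (ℚ; 0ℚ; 1ℚ; mkℚ)
import Data.Rational.Properties as ℚ
import Data.Rational.Unnormalised.Base as ℚᵘ
import Data.Rational.Unnormalised.Properties as ℚᵘ
open import Data.Sum.Base using (_⊎_; inj₁; inj₂; [_,_]′)
open import Data.Vec.Base as Vec using (Vec; lookup)
open import Data.Vec.Properties using (tabulate∘lookup; tabulate-cong)
open import Data.Vec.Relation.Unary.Unique.Propositional using (Unique)
import Data.Vec.Relation.Unary.Unique.Propositional.Properties as Vec
open import Defs
open import Function.Base using (_∘_; id; case_of_)
open import Relation.Binary.Construct.Closure.ReflexiveTransitive using (ε; _◅_)
import Relation.Binary.Construct.On as On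
open import Relation.Binary.Definitions using (tri<; tri≈; tri>)
open import Relation.Binary.PropositionalEquality
open import Relation.Nullary using (¬_; Dec; yes; no; contradiction)
open import Relation.Nullary.Decidable using (_×-dec_)
import Relation.Unary as Unary

open Exp (CommutativeRing.commutativeSemiring ℚ.+-*-commutativeRing) using ()
  renaming (^-distrib-* to ^ℚ-distrib-*)
open Group ℚ.+-0-group using () renaming (⁻¹-involutive to neg-involutive)

-- Growth of polynomials against exponentials.

^-distribʳ-* : ∀ a b t → (a * b) ^ t ≡ a ^ t * b ^ t
^-distribʳ-* a b zero    = refl
^-distribʳ-* a b (suc t) = trans (cong (a * b *_) (^-distribʳ-* a b t)) (eq a b (a ^ t) (b ^ t))
  where
  eq : ∀ a b x y → a * b * (x * y) ≡ a * x * (b * y)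
  eq = solve-∀

-- Bernoulli's inequality in the form (1 + 1/a)^t ≥ t/a, with denominators cleared.
bernoulli : ∀ a t → t * a ^ t ≤ a * suc a ^ t
bernoulli a zero    = z≤n
bernoulli a (suc t) = begin
  suc t * (a * a ^ t)                   ≡⟨ eq a t (a ^ t) ⟩
  a * a ^ t + a * (t * a ^ t)           ≤⟨ +-mono-≤ (*-monoʳ-≤ a (^-monoˡ-≤ t (n≤1+n a))) (*-monoʳ-≤ a (bernoulli a t)) ⟩
  a * suc a ^ t + a * (a * suc a ^ t)   ≡⟨ eq′ a (suc a ^ t) ⟩
  a * (suc a * suc a ^ t)               ∎
  where
  open ≤-Reasoning
  eq : ∀ a t x → suc t * (a * x) ≡ a * x + a * (t * x)
  eq = solve-∀
  eq′ : ∀ a y → a * y + a * (a * y) ≡ a * (suc a * y)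
  eq′ = solve-∀

polynomial≤exponential : ∀ s {a b} → a < b → ∃ λ C → ∀ t → t ^ s * a ^ t ≤ C * b ^ t
polynomial≤exponential zero        a<b = 1 , λ t → *-monoʳ-≤ 1 (^-monoˡ-≤ t (<⇒≤ a<b))
-- Half of the gap between 2a and 2b is spent on a single factor t, the other half on t ^ s.
polynomial≤exponential (suc s) {a} {b} a<b = C * (2 * a) , λ t → *-cancelˡ-≤ (2 ^ t) {{m^n≢0 2 t}} (begin
  2 ^ t * (t ^ suc s * a ^ t)              ≡⟨ eq (2 ^ t) t (t ^ s) (a ^ t) ⟩
  t ^ s * (t * (2 ^ t * a ^ t))            ≡⟨ cong (λ x → t ^ s * (t * x)) (^-distribʳ-* 2 a t) ⟨
  t ^ s * (t * (2 * a) ^ t)                ≤⟨ *-monoʳ-≤ (t ^ s) (bernoulli (2 * a) t) ⟩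
  t ^ s * (2 * a * suc (2 * a) ^ t)        ≡⟨ eq′ (t ^ s) (2 * a) (suc (2 * a) ^ t) ⟩
  2 * a * (t ^ s * suc (2 * a) ^ t)        ≤⟨ *-monoʳ-≤ (2 * a) (bound t) ⟩
  2 * a * (C * (2 * b) ^ t)                ≡⟨ cong (λ x → 2 * a * (C * x)) (^-distribʳ-* 2 b t) ⟩
  2 * a * (C * (2 ^ t * b ^ t))            ≡⟨ eq″ (2 * a) C (2 ^ t) (b ^ t) ⟩
  2 ^ t * (C * (2 * a) * b ^ t)            ∎)
  where
  open ≤-Reasoning
  2a+1<2b : suc (2 * a) < 2 * b
  2a+1<2b = subst (_≤ 2 * b) (*-suc 2 a) (*-monoʳ-≤ 2 a<b)
  hyp = polynomial≤exponential s 2a+1<2b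
  C = proj₁ hyp
  bound = proj₂ hyp
  eq : ∀ p t x y → p * (t * x * y) ≡ x * (t * (p * y))
  eq = solve-∀
  eq′ : ∀ x a y → x * (a * y) ≡ a * (x * y)
  eq′ = solve-∀
  eq″ : ∀ a C p y → a * (C * (p * y)) ≡ p * (C * a * y)
  eq″ = solve-∀

-- The weak bound is applied with exponent s + 1. Once the extra factor t exceeds K C, it absorbs
-- both constants and makes the inequality strict.
polynomial<exponential : ∀ K s {a b} → a < b → ∃ λ N → ∀ t → N ≤ t → K * t ^ s * a ^ t < b ^ t
polynomial<exponential K s {a} {b} a<b =
  suc (K * C) , λ t KC<t → *-cancelˡ-< t _ _ (begin-strict
    t * (K * t ^ s * a ^ t)   ≡⟨ eq t K (t ^ s) (a ^ t) ⟩
    K * (t ^ suc s * a ^ t)   ≤⟨ *-monoʳ-≤ K (bound t) ⟩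
    K * (C * b ^ t)           ≡⟨ *-assoc K C (b ^ t) ⟨
    K * C * b ^ t             <⟨ *-monoˡ-< (b ^ t) {{m^n≢0 b t {{>-nonZero (≤-<-trans z≤n a<b)}}}} KC<t ⟩
    t * b ^ t                 ∎)
  where
  open ≤-Reasoning
  hyp = polynomial≤exponential (suc s) a<b
  C = proj₁ hyp
  bound = proj₂ hyp
  eq : ∀ t K x y → t * (K * x * y) ≡ K * (t * x * y)
  eq = solve-∀

-- Naturals as rationals, and limits of t-th roots.

fromℕ-mono-< : ∀ {m n} → m < n → fromℕ m ℚ.< fromℕ n
fromℕ-mono-< {m} {n} m<n = ℚ.toℚᵘ-cancel-< (ℚᵘ.<-respʳ-≃ (ℚᵘ.≃-sym (ℚ.toℚᵘ-fromℚᵘ (ℚᵘ.mkℚᵘ (ℤ.+ n) 0)))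
  (ℚᵘ.<-respˡ-≃ (ℚᵘ.≃-sym (ℚ.toℚᵘ-fromℚᵘ (ℚᵘ.mkℚᵘ (ℤ.+ m) 0)))
    (ℚᵘ.*<* (subst₂ ℤ._<_ (sym (ℤ.*-identityʳ (ℤ.+ m))) (sym (ℤ.*-identityʳ (ℤ.+ n))) (ℤ.+<+ m<n)))))

fromℕ-homo-* : ∀ m n → fromℕ (m * n) ≡ fromℕ m ℚ.* fromℕ n
fromℕ-homo-* m n = ℚ.toℚᵘ-injective (begin
  ℚ.toℚᵘ (fromℕ (m * n))                      ≈⟨ ℚ.toℚᵘ-fromℚᵘ (ℚᵘ.mkℚᵘ (ℤ.+ (m * n)) 0) ⟩
  ℚᵘ.mkℚᵘ (ℤ.+ (m * n)) 0                     ≡⟨ cong (λ i → ℚᵘ.mkℚᵘ i 0) (ℤ.pos-* m n) ⟩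
  ℚᵘ.mkℚᵘ (ℤ.+ m) 0 ℚᵘ.* ℚᵘ.mkℚᵘ (ℤ.+ n) 0    ≈⟨ ℚᵘ.*-cong (ℚ.toℚᵘ-fromℚᵘ (ℚᵘ.mkℚᵘ (ℤ.+ m) 0)) (ℚ.toℚᵘ-fromℚᵘ (ℚᵘ.mkℚᵘ (ℤ.+ n) 0)) ⟨
  ℚ.toℚᵘ (fromℕ m) ℚᵘ.* ℚ.toℚᵘ (fromℕ n)      ≈⟨ ℚ.toℚᵘ-homo-* (fromℕ m) (fromℕ n) ⟨
  ℚ.toℚᵘ (fromℕ m ℚ.* fromℕ n)                ∎)
  where open ℚᵘ.≃-Reasoning

fromℕ-suc : ∀ n → fromℕ (suc n) ≡ fromℕ n ℚ.+ 1ℚ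
fromℕ-suc n = ℚ.toℚᵘ-injective (begin
  ℚ.toℚᵘ (fromℕ (suc n))              ≈⟨ ℚ.toℚᵘ-fromℚᵘ (ℚᵘ.mkℚᵘ (ℤ.+ suc n) 0) ⟩
  ℚᵘ.mkℚᵘ (ℤ.+ suc n) 0               ≡⟨ cong (λ k → ℚᵘ.mkℚᵘ (ℤ.+ k) 0) (trans (+-comm 1 n) (cong (_+ 1) (sym (*-identityʳ n)))) ⟩
  ℚᵘ.mkℚᵘ (ℤ.+ (n * 1 + 1)) 0         ≡⟨ cong (λ i → ℚᵘ.mkℚᵘ (i ℤ.+ ℤ.+ 1) 0) (ℤ.pos-* n 1) ⟩
  ℚᵘ.mkℚᵘ (ℤ.+ n) 0 ℚᵘ.+ ℚᵘ.1ℚᵘ       ≈⟨ ℚᵘ.+-congˡ ℚᵘ.1ℚᵘ (ℚ.toℚᵘ-fromℚᵘ (ℚᵘ.mkℚᵘ (ℤ.+ n) 0)) ⟨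
  ℚ.toℚᵘ (fromℕ n) ℚᵘ.+ ℚ.toℚᵘ 1ℚ     ≈⟨ ℚ.toℚᵘ-homo-+ (fromℕ n) 1ℚ ⟨
  ℚ.toℚᵘ (fromℕ n ℚ.+ 1ℚ)             ∎)
  where open ℚᵘ.≃-Reasoning

fromℕ-homo-^ : ∀ n t → fromℕ (n ^ t) ≡ fromℕ n ^ℚ t
fromℕ-homo-^ n zero    = refl
fromℕ-homo-^ n (suc t) = trans (fromℕ-homo-* n (n ^ t)) (cong (fromℕ n ℚ.*_) (fromℕ-homo-^ n t))

fromℕ-pos : ∀ n .{{_ : NonZero n}} → ℚ.Positive (fromℕ n)
fromℕ-pos n = ℚ.normalize-pos n 1

fromℕ-cancelʳ-< : ∀ k .{{_ : NonZero k}} {p q} → p ℚ.* fromℕ k ℚ.< q ℚ.* fromℕ k → p ℚ.< q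
fromℕ-cancelʳ-< k = ℚ.*-cancelʳ-<-nonNeg (fromℕ k) {{ℚ.pos⇒nonNeg (fromℕ k) {{fromℕ-pos k}}}}

divide : ∀ n k .{{_ : NonZero k}} → ∃ λ q → q ℚ.* fromℕ k ≡ fromℕ n
divide n k = fromℕ n ℚ.* (ℚ.1/ fromℕ k) , trans (ℚ.*-assoc (fromℕ n) (ℚ.1/ fromℕ k) (fromℕ k))
    (trans (cong (fromℕ n ℚ.*_) (ℚ.*-inverseˡ (fromℕ k))) (ℚ.*-identityʳ (fromℕ n)))
  where instance _ = ℚ.pos⇒nonZero (fromℕ k) {{fromℕ-pos k}}

-- A denominator is at least 1, so a fraction is below the absolute value of its numerator plus 1.
<fromℕ : ∀ q → ∃ λ k → NonZero k × q ℚ.< fromℕ k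
<fromℕ q@(mkℚ n d _) = suc ℤ.∣ n ∣ , _ , ℚ.toℚᵘ-cancel-< (ℚᵘ.<-respʳ-≃
  (ℚᵘ.≃-sym (ℚ.toℚᵘ-fromℚᵘ (ℚᵘ.mkℚᵘ (ℤ.+ suc ℤ.∣ n ∣) 0))) (ℚᵘ.*<* (begin-strict
    n ℤ.* ℤ.+ 1                       ≡⟨ ℤ.*-identityʳ n ⟩
    n                                 ≤⟨ i≤∣i∣ n ⟩
    ℤ.+ ℤ.∣ n ∣                       <⟨ ℤ.+<+ (m≤m*n (suc ℤ.∣ n ∣) (suc d)) ⟩
    ℤ.+ (suc ℤ.∣ n ∣ * suc d)         ≡⟨ ℤ.pos-* (suc ℤ.∣ n ∣) (suc d) ⟩
    ℤ.+ suc ℤ.∣ n ∣ ℤ.* ℤ.+ suc d     ∎)))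
  where
  open ℤ.≤-Reasoning
  i≤∣i∣ : ∀ i → i ℤ.≤ ℤ.+ ℤ.∣ i ∣
  i≤∣i∣ (ℤ.+ n)    = ℤ.≤-refl
  i≤∣i∣ ℤ.-[1+ n ] = ℤ.-≤+

archimedean : ∀ δ → 0ℚ ℚ.< δ → ∃ λ k → NonZero k × 1ℚ ℚ.< δ ℚ.* fromℕ k
archimedean δ 0<δ = let k , k≢0 , 1/δ<k = <fromℕ (ℚ.1/ δ) in
  k , k≢0 , subst (ℚ._< δ ℚ.* fromℕ k) (ℚ.*-inverseʳ δ) (ℚ.*-monoʳ-<-pos δ 1/δ<k)
  where
  instance
    _ = ℚ.positive 0<δ
    _ = ℚ.pos⇒nonZero δ

-- For q = n/k this is q^t = n^t/k^t without division. Comparing q^t with a natural number thereby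
-- becomes a comparison in ℕ.
^ℚ-clear : ∀ {q} n k t → q ℚ.* fromℕ k ≡ fromℕ n → q ^ℚ t ℚ.* fromℕ (k ^ t) ≡ fromℕ (n ^ t)
^ℚ-clear {q} n k t qk≡n = begin
  q ^ℚ t ℚ.* fromℕ (k ^ t)   ≡⟨ cong (q ^ℚ t ℚ.*_) (fromℕ-homo-^ k t) ⟩
  q ^ℚ t ℚ.* fromℕ k ^ℚ t    ≡⟨ ^ℚ-distrib-* q (fromℕ k) t ⟨
  (q ℚ.* fromℕ k) ^ℚ t       ≡⟨ cong (_^ℚ t) qk≡n ⟩
  fromℕ n ^ℚ t               ≡⟨ fromℕ-homo-^ n t ⟨
  fromℕ (n ^ t)              ∎
  where open ≡-Reasoning

module _ {q : ℚ} (n k : ℕ) .{{_ : NonZero k}} (t : ℕ) (qk≡n : q ℚ.* fromℕ k ≡ fromℕ n) where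
  private
    instance _ = m^n≢0 k t

  ^ℚ-<-fromℕ : ∀ a → n ^ t < a * k ^ t → q ^ℚ t ℚ.< fromℕ a
  ^ℚ-<-fromℕ a nᵗ<akᵗ = fromℕ-cancelʳ-< (k ^ t) (subst₂ ℚ._<_
    (sym (^ℚ-clear n k t qk≡n)) (fromℕ-homo-* a (k ^ t)) (fromℕ-mono-< nᵗ<akᵗ))

  fromℕ-<-^ℚ : ∀ a → a * k ^ t < n ^ t → fromℕ a ℚ.< q ^ℚ t
  fromℕ-<-^ℚ a akᵗ<nᵗ = fromℕ-cancelʳ-< (k ^ t) (subst₂ ℚ._<_
    (fromℕ-homo-* a (k ^ t)) (sym (^ℚ-clear n k t qk≡n)) (fromℕ-mono-< akᵗ<nᵗ))

-- The factor K t^s is swallowed by any gap between exponential bases. With 1 < δ k, the rational q₁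
-- = (c k - 1)/k lies above c - δ and q₂ = (c k + 1)/k below c + δ. For large t the root lies
-- between them, so they are the separating rationals that `_<ᴿ_` asks for.
root-limit : ∀ (A : ℕ → ℕ) c K s .{{_ : NonZero c}} →
  (∀ t .{{_ : NonZero t}} → A t ≤ K * t ^ s * c ^ t) →
  (∀ t .{{_ : NonZero t}} → c ^ t ≤ K * t ^ s * A t) →
  (λ t → root t (A t)) ⟶ fromℚ (fromℕ c)
root-limit A c K s A≤ ≤A δ 0<δ = N , λ t N≤t →
    (q₁ , below , inj₂ (^ℚ-<-fromℕ n₁ k t q₁k≡n₁ (A t) (lower t (≤-trans (m≤m⊔n N₁ N₂) N≤t)))) ,
    (q₂ , (0<q₂ , fromℕ-<-^ℚ n₂ k t q₂k≡n₂ (A t) (upper t (≤-trans (m≤n⊔m N₁ N₂) N≤t))) , above)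
  where
  k = proj₁ (archimedean δ 0<δ)
  1<δk = proj₂ (proj₂ (archimedean δ 0<δ))
  instance
    k≢0 = proj₁ (proj₂ (archimedean δ 0<δ))
    ck≢0 = m*n≢0 c k
  n₁ = pred (c * k)
  n₂ = suc (c * k)
  1+n₁≡ck : suc n₁ ≡ c * k
  1+n₁≡ck = suc-pred (c * k)
  q₁ = proj₁ (divide n₁ k)
  q₁k≡n₁ = proj₂ (divide n₁ k)
  q₂ = proj₁ (divide n₂ k)
  q₂k≡n₂ = proj₂ (divide n₂ k)
  growth₁ = polynomial<exponential K s (≤-reflexive 1+n₁≡ck)
  growth₂ = polynomial<exponential K s (n<1+n (c * k))
  N₁ = proj₁ growth₁
  N₂ = proj₁ growth₂
  N = N₁ ⊔ N₂

  lower : ∀ t .{{_ : NonZero t}} → N₁ ≤ t → n₁ ^ t < A t * k ^ t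
  lower t N₁≤t = *-cancelˡ-< (K * t ^ s) _ _ (begin-strict
    K * t ^ s * n₁ ^ t         <⟨ proj₂ growth₁ t N₁≤t ⟩
    (c * k) ^ t                ≡⟨ ^-distribʳ-* c k t ⟩
    c ^ t * k ^ t              ≤⟨ *-monoˡ-≤ (k ^ t) (≤A t) ⟩
    K * t ^ s * A t * k ^ t    ≡⟨ *-assoc (K * t ^ s) (A t) (k ^ t) ⟩
    K * t ^ s * (A t * k ^ t)  ∎)
    where open ≤-Reasoning

  upper : ∀ t .{{_ : NonZero t}} → N₂ ≤ t → A t * k ^ t < n₂ ^ t
  upper t N₂≤t = begin-strict
    A t * k ^ t                ≤⟨ *-monoˡ-≤ (k ^ t) (A≤ t) ⟩
    K * t ^ s * c ^ t * k ^ t  ≡⟨ *-assoc (K * t ^ s) (c ^ t) (k ^ t) ⟩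
    K * t ^ s * (c ^ t * k ^ t) ≡⟨ cong (K * t ^ s *_) (^-distribʳ-* c k t) ⟨
    K * t ^ s * (c * k) ^ t    <⟨ proj₂ growth₂ t N₂≤t ⟩
    n₂ ^ t                     ∎
    where open ≤-Reasoning

  -- Used for q₁, where `suc n₁` is c k, and for c itself, where `suc (c * k)` is `n₂`.
  c*k+1< : ∀ {q} n → q ℚ.* fromℕ k ≡ fromℕ n → fromℕ (suc n) ℚ.< (q ℚ.+ δ) ℚ.* fromℕ k
  c*k+1< {q} n qk≡n = begin-strict
    fromℕ (suc n)                    ≡⟨ fromℕ-suc n ⟩
    fromℕ n ℚ.+ 1ℚ                   <⟨ ℚ.+-monoʳ-< (fromℕ n) 1<δk ⟩
    fromℕ n ℚ.+ δ ℚ.* fromℕ k        ≡⟨ cong (ℚ._+ δ ℚ.* fromℕ k) qk≡n ⟨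
    q ℚ.* fromℕ k ℚ.+ δ ℚ.* fromℕ k  ≡⟨ ℚ.*-distribʳ-+ (fromℕ k) q δ ⟨
    (q ℚ.+ δ) ℚ.* fromℕ k            ∎
    where open ℚ.≤-Reasoning

  below : fromℕ c ℚ.< q₁ ℚ.- ℚ.- δ
  below = subst (λ x → fromℕ c ℚ.< q₁ ℚ.+ x) (sym (neg-involutive δ)) (fromℕ-cancelʳ-< k
    (subst (ℚ._< (q₁ ℚ.+ δ) ℚ.* fromℕ k) (trans (cong fromℕ 1+n₁≡ck) (fromℕ-homo-* c k)) (c*k+1< {q₁} n₁ q₁k≡n₁)))

  above : q₂ ℚ.- δ ℚ.< fromℕ c
  above = subst (q₂ ℚ.- δ ℚ.<_) (trans (ℚ.+-assoc (fromℕ c) δ (ℚ.- δ))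
      (trans (cong (fromℕ c ℚ.+_) (ℚ.+-inverseʳ δ)) (ℚ.+-identityʳ (fromℕ c))))
    (ℚ.+-monoˡ-< (ℚ.- δ) {q₂} {fromℕ c ℚ.+ δ} (fromℕ-cancelʳ-< k (subst (ℚ._< (fromℕ c ℚ.+ δ) ℚ.* fromℕ k)
      (sym q₂k≡n₂) (c*k+1< {fromℕ c} (c * k) (sym (fromℕ-homo-* c k))))))

  0<q₂ : 0ℚ ℚ.< q₂
  0<q₂ = fromℕ-cancelʳ-< k (subst₂ ℚ._<_ (sym (ℚ.*-zeroˡ (fromℕ k))) (sym q₂k≡n₂)
    (fromℕ-mono-< (z<s {c * k})))

-- Counting by injections; permutations as words.

module _ {A : Set} where

  List-lookup-injective : ∀ {xs : List A} → List.Unique xs → ∀ {i j} → List.lookup xs i ≡ List.lookup xs j → i ≡ j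
  List-lookup-injective (_  ∷ _) {zero}  {zero}  _  = refl
  List-lookup-injective (x∉ ∷ _) {zero}  {suc j} eq = contradiction eq (All.lookup x∉ (∈-lookup j))
  List-lookup-injective (x∉ ∷ _) {suc i} {zero}  eq = contradiction (sym eq) (All.lookup x∉ (∈-lookup i))
  List-lookup-injective (_  ∷ u) {suc i} {suc j} eq = cong suc (List-lookup-injective u eq)

  module _ {P : A → Set} (P? : Unary.Decidable P) (xs : List A) where

    length-filter≤ : ∀ {m} → List.Unique xs → (f : A → Fin m) →
      (∀ {x y} → P x → P y → f x ≡ f y → x ≡ y) → length (filter P? xs) ≤ m
    length-filter≤ u f f-inj = Fin.injective⇒≤ {f = f ∘ List.lookup (filter P? xs)} λ {i} {j} eq →
      List-lookup-injective (List.filter⁺ P? u)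
        (f-inj (proj₂ (∈-filter⁻ P? {xs = xs} (∈-lookup i))) (proj₂ (∈-filter⁻ P? {xs = xs} (∈-lookup j))) eq)

    ≤length-filter : ∀ {m} → (∀ x → x ∈ xs) → (g : Fin m → A) →
      (∀ i → P (g i)) → (∀ {i j} → g i ≡ g j → i ≡ j) → m ≤ length (filter P? xs)
    ≤length-filter ∈xs g P∘g g-inj = Fin.injective⇒≤ {f = λ i → Any.index (g∈ i)} λ {i} {j} eq →
      g-inj (trans (lookup-index (g∈ i))
        (trans (cong (List.lookup (filter P? xs)) eq) (sym (lookup-index (g∈ j)))))
      where
      g∈ : ∀ i → g i ∈ filter P? xs
      g∈ i = ∈-filter⁺ P? (∈xs (g i)) (P∘g i)

-- Pigeonhole: if v were missed, punching it out would inject n + 1 positions into n values.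
permutation-surjective : ∀ {n} {w : Word n n} → IsPermutation w → ∀ v → ∃ λ k → lookup w k ≡ v
permutation-surjective {suc n} {w} u v with Fin.any? (λ k → lookup w k Fin.≟ v)
... | yes found = found
... | no ¬found = contradiction (Fin.injective⇒≤ {f = λ k → punchOut (v≢ k)} λ {i} {j} eq →
        Vec.lookup-injective u i j (Fin.punchOut-injective (v≢ i) (v≢ j) eq)) 1+n≰n
  where
  v≢ : ∀ k → v ≢ lookup w k
  v≢ k eq = ¬found (k , sym eq)

module _ {n m : ℕ} {w : Word n m} (u : Unique w) where

  Precedes-asym : ∀ {x y} → Precedes w x y → ¬ Precedes w y x
  Precedes-asym (k , l , k<l , refl , refl) (l′ , k′ , l′<k′ , eq₁ , eq₂)
    with refl ← Vec.lookup-injective u l′ l eq₁ | refl ← Vec.lookup-injective u k′ k eq₂ = <-asym k<l l′<k′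

  Precedes-trans : ∀ {x y z} → Precedes w x y → Precedes w y z → Precedes w x z
  Precedes-trans (k , l , k<l , eq , refl) (l′ , m , l′<m , eq₁ , eq₂)
    with refl ← Vec.lookup-injective u l′ l eq₁ = k , m , <-trans k<l l′<m , eq , eq₂

word-ext : ∀ {n m} {w w′ : Word n m} → (∀ k → lookup w k ≡ lookup w′ k) → w ≡ w′
word-ext {w = w} {w′} eq = trans (sym (tabulate∘lookup w)) (trans (tabulate-cong eq) (tabulate∘lookup w′))

-- Upper bound: encoding extensions by their left-to-right maxima.

tooth-chain : ∀ {s t} (i : Fin s) {j j′ : Fin t} → j Fin.≤ j′ → Comb (i , j) (i , j′)
tooth-chain i {j} {j′} j≤j′ = go (toℕ j′ ∸ toℕ j) (sym (m∸n+n≡m j≤j′))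
  where
  go : ∀ d {j} → toℕ j′ ≡ d + toℕ j → Comb (i , j) (i , j′)
  go zero    eq = subst (λ l → Comb (i , _) (i , l)) (Fin.toℕ-injective (sym eq)) ε
  go (suc d) {j} eq = tooth k≡1+j ◅ go d
      (trans eq (trans (sym (+-suc d (toℕ j))) (cong (d +_) (sym k≡1+j))))
    where
    1+j<t = ≤-<-trans (subst (suc (toℕ j) ≤_) (sym eq) (s≤s (m≤n+m _ d))) (Fin.toℕ<n j′)
    k≡1+j = Fin.toℕ-fromℕ< 1+j<t

module _ {s t : ℕ} {w : Word (s * t) (s * t)} (ext : IsLinearExtension (Kᵝ s t) w) where

  tooth-precedes : ∀ i {j j′ : Fin t} → j Fin.< j′ → Precedes w (combine i j) (combine i j′)
  tooth-precedes i {j} {j′} j<j′ = proj₂ ext _ _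
    ( subst₂ Comb (sym (Fin.remQuot-combine i j)) (sym (Fin.remQuot-combine i j′)) (tooth-chain i (<⇒≤ j<j′))
    , λ eq → <⇒≢ j<j′ (cong toℕ (Fin.combine-injectiveʳ i j i j′ eq)))

-- The least index satisfying P, or t if there is none. It determines P when P is upward closed.
threshold : ∀ {t} {P : Fin t → Set} → Unary.Decidable P → Fin (suc t)
threshold {zero}  P? = zero
threshold {suc t} P? with P? zero
... | yes _ = zero
... | no  _ = suc (threshold (P? ∘ suc))

threshold-≤ : ∀ {t} {P : Fin t → Set} (P? : Unary.Decidable P) {j} → P j → toℕ (threshold P?) ≤ toℕ j
threshold-≤ {suc t} P? {j} pj with P? zero
... | yes _ = z≤n
threshold-≤ {suc t} P? {zero}  p0 | no ¬p0 = contradiction p0 ¬p0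
threshold-≤ {suc t} P? {suc j} pj | no _   = s≤s (threshold-≤ (P? ∘ suc) pj)

≤-threshold : ∀ {t} {P : Fin t → Set} (P? : Unary.Decidable P) → (∀ {j j′} → j Fin.≤ j′ → P j → P j′) →
              ∀ {j} → toℕ (threshold P?) ≤ toℕ j → P j
≤-threshold {suc t} P? up {j} le with P? zero
... | yes p0 = up z≤n p0
≤-threshold {suc t} P? up {suc j} (s≤s le) | no _ = ≤-threshold (P? ∘ suc) (λ j≤j′ → up (s≤s j≤j′)) le

-- For a permutation w: the value v is not a left-to-right maximum of w.
Low : ∀ {n m} → Word n m → Fin n → Set
Low w v = ∃ λ u → v Fin.< u × Precedes w u v

low? : ∀ {n m} (w : Word n m) → Unary.Decidable (Low w)
low? w v = Fin.any? λ u → v Fin.<? u ×-dec precedes? w u v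

bit : {P : Set} → Dec P → Fin 2
bit (yes _) = suc zero
bit (no  _) = zero

bit-≡ : {P Q : Set} {p? : Dec P} {q? : Dec Q} → bit p? ≡ bit q? → P → Q
bit-≡ {q? = yes q} _ _ = q
bit-≡ {p? = no ¬p} {no _} _ p = contradiction p ¬p

-- Labels are ordered by tooth first, so a label of another tooth lies below or above the whole
-- block.
block-convex : ∀ {s t} (i : Fin s) {j j′ : Fin t} {u} → combine i j Fin.< u → u Fin.< combine i j′ →
               ∃ λ k → u ≡ combine i k
block-convex {s} {t} i {j} {j′} {u} v<u u<v′ with remQuot {s} t u in eq
... | i′ , k = k , trans (sym u≡) (cong (λ i → combine i k) i′≡i)
  where
  u≡ : combine i′ k ≡ u
  u≡ = trans (cong (uncurry combine) (sym eq)) (Fin.combine-remQuot {s} t u)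
  i′≡i : i′ ≡ i
  i′≡i with Fin.<-cmp i′ i
  ... | tri< i′<i _ _ = contradiction (subst (Fin._< combine i j) u≡ (Fin.combine-monoˡ-< k j i′<i)) (<-asym v<u)
  ... | tri≈ _ i′≡i _ = i′≡i
  ... | tri> _ _ i<i′ = contradiction (subst (combine i j′ Fin.<_) u≡ (Fin.combine-monoˡ-< j′ k i<i′)) (<-asym u<v′)

module _ {s t : ℕ} where

  -- Let u exceed and precede the letter of j. If u also exceeds the letter of j′, it witnesses that
  -- this one is low, since j comes before j′. Otherwise u belongs to the same tooth, above j, and
  -- cannot precede j.
  Low-upward : ∀ {w} → IsLinearExtension (Kᵝ s t) w → ∀ (i : Fin s) {j j′ : Fin t} →
               j Fin.≤ j′ → Low w (combine i j) → Low w (combine i j′)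
  Low-upward {w} ext@(uniq , _) i {j} {j′} j≤j′ low@(u , v<u , u→v) with Fin.<-cmp j j′
  ... | tri≈ _ refl _ = low
  ... | tri> _ _ j′<j = contradiction j≤j′ (<⇒≱ j′<j)
  ... | tri< j<j′ _ _ with Fin.<-cmp u (combine i j′)
  ...   | tri> _ _ v′<u = u , v′<u , Precedes-trans uniq u→v (tooth-precedes ext i j<j′)
  ...   | tri≈ _ refl _ = contradiction u→v (Precedes-asym uniq (tooth-precedes ext i j<j′))
  ...   | tri< u<v′ _ _ with k , refl ← block-convex i v<u u<v′ =
    contradiction u→v (Precedes-asym uniq (tooth-precedes ext i (≰⇒> λ k≤j → <⇒≱ v<u (combine-mono k≤j))))
    where
    combine-mono : ∀ {k} → k Fin.≤ j → combine i k Fin.≤ combine i j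
    combine-mono {k} k≤j = subst₂ _≤_ (sym (Fin.toℕ-combine i k)) (sym (Fin.toℕ-combine i j)) (+-monoʳ-≤ (t * toℕ i) k≤j)

  private
    Word′ = Word (s * t) (s * t)

    lowIn? : ∀ (w : Word′) (i : Fin s) → Unary.Decidable {A = Fin t} (λ j → Low w (combine i j))
    lowIn? w i j = low? w (combine i j)

    positions : Word′ → Fin (s * t) → Fin 2
    positions w k = bit (low? w (lookup w k))

    values : Word′ → Fin s → Fin (suc t)
    values w i = threshold (lowIn? w i)

  -- The two kinds of data packed into one number: a bit per position, 1 where the letter is low,
  -- and per tooth the index of its first low element. The size of the `Fin` is the upper bound
  -- sought.
  code : Word′ → Fin (2 ^ (s * t) * suc t ^ s)
  code w = combine (funToFin (positions w)) (funToFin (values w))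

  private
    funToFin-injective : ∀ {m n} {f g : Fin m → Fin n} → funToFin f ≡ funToFin g → ∀ i → f i ≡ g i
    funToFin-injective {f = f} {g} eq i = trans (sym (Fin.finToFun-funToFin f i))
      (trans (cong (λ x → finToFun x i) eq) (Fin.finToFun-funToFin g i))

  code-Low-lookup : ∀ w w′ → code w ≡ code w′ → ∀ k → Low w (lookup w k) → Low w′ (lookup w′ k)
  code-Low-lookup w w′ eq k = bit-≡ {p? = low? w (lookup w k)} {low? w′ (lookup w′ k)}
    (funToFin-injective (Fin.combine-injectiveˡ (funToFin (positions w)) _ (funToFin (positions w′)) _ eq) k)

  -- Equal bits transfer lowness by position; equal thresholds transfer it by value. A low element
  -- is at or above the threshold of its tooth, and in w′ everything from that threshold on is low.
  code-Low : ∀ w {w′} → IsLinearExtension (Kᵝ s t) w′ → code w ≡ code w′ → ∀ v → Low w v → Low w′ v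
  code-Low w {w′} ext′ eq v low = subst (Low w′) ij≡v (≤-threshold (lowIn? w′ i) (Low-upward ext′ i)
      (subst (λ a → toℕ a ≤ toℕ j) (funToFin-injective values≡ i)
        (threshold-≤ (lowIn? w i) (subst (Low w) (sym ij≡v) low))))
    where
    i = proj₁ (remQuot {s} t v)
    j = proj₂ (remQuot {s} t v)
    ij≡v : combine i j ≡ v
    ij≡v = Fin.combine-remQuot {s} t v
    values≡ = Fin.combine-injectiveʳ (funToFin (positions w)) _ (funToFin (positions w′)) _ eq

  Valid : Word′ → Set
  Valid w = IsLinearExtension (Kᵝ s t) w × Avoids321 w

  -- If w has v and w′ has v′ > v at position k, after a common prefix, then v comes
  -- later in w′, so it is low; hence position k is low, and v′ is the middle of a 321 in w′.
  code-≮ : ∀ {w w′} → Valid w → Valid w′ → code w ≡ code w′ → ∀ k →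
           (∀ l → l Fin.< k → lookup w l ≡ lookup w′ l) → ¬ lookup w k Fin.< lookup w′ k
  code-≮ {w} {w′} (ext@(uniq , _) , _) ((uniq′ , _) , avoids′) eq k agree v<v′
    with l , w′l≡v ← permutation-surjective uniq′ (lookup w k) = contra (code-Low-lookup w w′ eq k
      (code-Low w′ ext (sym eq) (lookup w k) (lookup w′ k , v<v′ , k , l , k<l , refl , w′l≡v)))
    where
    k<l : k Fin.< l
    k<l with Fin.<-cmp k l
    ... | tri< k<l _ _ = k<l
    ... | tri≈ _ refl _ = contradiction (cong toℕ (sym w′l≡v)) (<⇒≢ v<v′)
    ... | tri> _ _ l<k = contradiction (Vec.lookup-injective uniq l k (trans (agree l l<k) w′l≡v)) (λ { refl → <-irrefl refl l<k })
    contra : ¬ Low w′ (lookup w′ k)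
    contra (_ , v′<u , m , k′ , m<k′ , refl , w′k′≡v′) with refl ← Vec.lookup-injective uniq′ k′ k w′k′≡v′ =
      avoids′ (m , k , l , m<k′ , k<l , v′<u , subst (Fin._< lookup w′ k) (sym w′l≡v) v<v′)

  -- Strong induction on the position: after a common prefix neither letter can be the smaller one.
  code-injective : ∀ {w w′} → Valid w → Valid w′ → code w ≡ code w′ → w ≡ w′
  code-injective {w} {w′} valid valid′ eq = word-ext λ k → go (suc (toℕ k)) k ≤-refl
    where
    go : ∀ n k → toℕ k < n → lookup w k ≡ lookup w′ k
    go (suc n) k (s≤s k≤n) with Fin.<-cmp (lookup w k) (lookup w′ k)
    ... | tri< lt _ _ = contradiction lt (code-≮ valid valid′ eq k λ l l<k → go n l (<-≤-trans l<k k≤n))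
    ... | tri≈ _ eq′ _ = eq′
    ... | tri> _ _ gt = contradiction gt (code-≮ valid′ valid (sym eq) k λ l l<k → sym (go n l (<-≤-trans l<k k≤n)))

A₃₂₁-Kᵝ≤ : ∀ s t → A₃₂₁ (Kᵝ s t) ≤ 2 ^ (s * t) * suc t ^ s
A₃₂₁-Kᵝ≤ s t = length-filter≤ _ _ (words-unique (s * t) (s * t)) (code {s} {t}) (code-injective {s} {t})

-- Words obtained by sorting the letters by a key.

fromList-lookup : ∀ {A : Set} {R : A → A → Set} {n} (xs : List A) → length xs ≡ n → AllPairs R xs →
                  ∃ λ (v : Vec A n) → ∀ {i j} → i Fin.< j → R (lookup v i) (lookup v j)
fromList-lookup {R = R} xs refl rs = Vec.fromList xs , λ {i} {j} → go xs rs i j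
  where
  all : ∀ {x} xs → All (R x) xs → ∀ j → R x (lookup (Vec.fromList xs) j)
  all (_ ∷ _)  (r ∷ _)  zero    = r
  all (_ ∷ xs) (_ ∷ rs) (suc j) = all xs rs j
  go : ∀ xs → AllPairs R xs → ∀ i j → i Fin.< j → R (lookup (Vec.fromList xs) i) (lookup (Vec.fromList xs) j)
  go (_ ∷ xs) (r ∷ _)  zero    (suc j) _         = all xs r j
  go (_ ∷ xs) (_ ∷ rs) (suc i) (suc j) (s≤s i<j) = go xs rs i j i<j

-- Precedence in the sorted word is comparison of keys. Extending the poset and avoiding 321 thus
-- reduce to inequalities between keys.
module Sorting {n : ℕ} (key : Fin n → ℕ) (key-injective : ∀ {x y} → key x ≡ key y → x ≡ y) where

  private
    open Sort (On.decTotalOrder ≤-decTotalOrder key)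

    sorted : AllPairs (λ x y → key x < key y) (sort (allFin n))
    sorted = AllPairs.zipWith (λ (x≤y , x≢y) → ≤∧≢⇒< x≤y (x≢y ∘ key-injective))
      ( Linked⇒AllPairs ≤-trans (sort-↗ (allFin n))
      , Permutationₛ.Unique-resp-↭ (setoid (Fin n)) (↭⇒↭ₛ (↭-sym (sort-↭ (allFin n)))) (List.allFin⁺ n))

    result = fromList-lookup {R = λ x y → key x < key y} (sort (allFin n))
      (trans (↭-length (sort-↭ (allFin n))) (length-tabulate {n = n} id)) sorted

  word : Word n n
  word = proj₁ result

  word-mono : ∀ {i j} → i Fin.< j → key (lookup word i) < key (lookup word j)
  word-mono = proj₂ result

  word-unique : IsPermutation word
  word-unique = subst Unique (tabulate∘lookup word) (Vec.tabulate⁺ λ {i} {j} eq → case Fin.<-cmp i j of λ where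
    (tri< i<j _ _) → contradiction (cong key eq) (<⇒≢ (word-mono i<j))
    (tri≈ _ i≡j _) → i≡j
    (tri> _ _ j<i) → contradiction (cong key (sym eq)) (<⇒≢ (word-mono j<i)))

  word-precedes : ∀ x y → key x < key y → Precedes word x y
  word-precedes x y x<y with permutation-surjective word-unique x | permutation-surjective word-unique y
  ... | i , refl | j , refl with Fin.<-cmp i j
  ...   | tri< i<j _ _  = i , j , i<j , refl , refl
  ...   | tri≈ _ refl _ = contradiction x<y (<-irrefl refl)
  ...   | tri> _ _ j<i  = contradiction (word-mono j<i) (<-asym x<y)

  word-precedes⁻ : ∀ x y → Precedes word x y → key x < key y
  word-precedes⁻ _ _ (i , j , i<j , refl , refl) = word-mono i<j

  word-extends : ∀ P → let open LabelledPoset P renaming (_≤_ to _≼_) in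
                 (∀ {x y} → x ≼ y → key x ≤ key y) → IsLinearExtension P word
  word-extends P mono = word-unique , λ x y (x≼y , x≢y) → word-precedes x y (≤∧≢⇒< (mono x≼y) (x≢y ∘ key-injective))

  -- Of the three letters of a 321, two lie in the same class.
  word-avoids : (class : Fin n → Bool) →
    (∀ {x y} → class x ≡ class y → x Fin.< y → key x < key y) → Avoids321 word
  word-avoids class mono (i , j , k , i<j , j<k , wj<wi , wk<wj) =
    pigeonhole (class (lookup word i)) (class (lookup word j)) (class (lookup word k))
      (λ eq → <-asym (word-mono i<j) (mono (sym eq) wj<wi))
      (λ eq → <-asym (word-mono j<k) (mono (sym eq) wk<wj))
      (λ eq → <-asym (word-mono (<-trans i<j j<k)) (mono (sym eq) (<-trans wk<wj wj<wi)))
    where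
    pigeonhole : ∀ a b c → a ≢ b → b ≢ c → a ≢ c → ⊥
    pigeonhole false false _     a≢b _   _   = a≢b refl
    pigeonhole false true  false _   _   a≢c = a≢c refl
    pigeonhole false true  true  _   b≢c _   = b≢c refl
    pigeonhole true  false false _   b≢c _   = b≢c refl
    pigeonhole true  false true  _   _   a≢c = a≢c refl
    pigeonhole true  true  _     a≢b _   _   = a≢b refl

-- Lattice paths and central binomial coefficients.

data Path : ℕ → ℕ → Set where
  []  : Path 0 0
  L∷_ : ∀ {p q} → Path p q → Path (suc p) q
  U∷_ : ∀ {p q} → Path p q → Path p (suc q)

-- The binomial coefficient C(p + q, p), by Pascal's rule on the first step of a path.
paths : ℕ → ℕ → ℕ
paths zero    zero    = 1
paths zero    (suc q) = paths zero q
paths (suc p) zero    = paths p zero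
paths (suc p) (suc q) = paths p (suc q) + paths (suc p) q

decode : ∀ p q → Fin (paths p q) → Path p q
decode zero    zero    _ = []
decode zero    (suc q) x = U∷ decode zero q x
decode (suc p) zero    x = L∷ decode p zero x
decode (suc p) (suc q) x with splitAt (paths p (suc q)) x
... | inj₁ y = L∷ decode p (suc q) y
... | inj₂ y = U∷ decode (suc p) q y

L∷-injective : ∀ {p q} {b b′ : Path p q} → L∷ b ≡ L∷ b′ → b ≡ b′
L∷-injective refl = refl

U∷-injective : ∀ {p q} {b b′ : Path p q} → U∷ b ≡ U∷ b′ → b ≡ b′
U∷-injective refl = refl

decode-injective : ∀ p q {x y} → decode p q x ≡ decode p q y → x ≡ y
decode-injective zero    zero    {zero} {zero} _ = refl
decode-injective zero    (suc q) eq = decode-injective zero q (U∷-injective eq)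
decode-injective (suc p) zero    eq = decode-injective p zero (L∷-injective eq)
decode-injective (suc p) (suc q) {x} {y} eq
  with splitAt (paths p (suc q)) x in eqx | splitAt (paths p (suc q)) y in eqy
... | inj₁ x′ | inj₁ y′ with refl ← decode-injective p (suc q) (L∷-injective eq) =
  trans (sym (Fin.splitAt⁻¹-↑ˡ eqx)) (Fin.splitAt⁻¹-↑ˡ eqy)
... | inj₂ x′ | inj₂ y′ with refl ← decode-injective (suc p) q (U∷-injective eq) =
  trans (sym (Fin.splitAt⁻¹-↑ʳ {paths p (suc q)} eqx)) (Fin.splitAt⁻¹-↑ʳ {paths p (suc q)} eqy)

-- In the main case Pascal's rule contributes p + 1 and q + 1 copies of (p + q + 1)!, together (p +
-- q + 2)!.
paths-! : ∀ p q → paths p q * (p ! * q !) ≡ (p + q) !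
paths-! zero    zero    = refl
paths-! zero    (suc q) = begin
  paths zero q * (1 * (suc q * q !))     ≡⟨ eq (paths zero q) (suc q) (q !) ⟩
  suc q * (paths zero q * (1 * q !))     ≡⟨ cong (suc q *_) (paths-! zero q) ⟩
  suc q * q !                            ∎
  where
  open ≡-Reasoning
  eq : ∀ x y z → x * (1 * (y * z)) ≡ y * (x * (1 * z))
  eq = solve-∀
paths-! (suc p) zero    = begin
  paths p zero * (suc p * p ! * 1)             ≡⟨ eq (paths p zero) (suc p) (p !) ⟩
  suc p * (paths p zero * (p ! * 1))           ≡⟨ cong (suc p *_) (paths-! p zero) ⟩
  suc p * (p + 0) !                            ≡⟨ cong (λ k → suc k * (p + 0) !) (+-identityʳ p) ⟨
  (suc p + 0) !                                ∎
  where
  open ≡-Reasoning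
  eq : ∀ x y z → x * (y * z * 1) ≡ y * (x * (z * 1))
  eq = solve-∀
paths-! (suc p) (suc q) = begin
  (paths p (suc q) + paths (suc p) q) * (suc p ! * suc q !)
    ≡⟨ eq (paths p (suc q)) (paths (suc p) q) (suc p) (p !) (suc q) (q !) ⟩
  suc p * (paths p (suc q) * (p ! * suc q !)) + suc q * (paths (suc p) q * (suc p ! * q !))
    ≡⟨ cong₂ (λ x y → suc p * x + suc q * y) (paths-! p (suc q)) (paths-! (suc p) q) ⟩
  suc p * (p + suc q) ! + suc q * (suc p + q) !
    ≡⟨ cong (λ k → suc p * (p + suc q) ! + suc q * k !) (+-suc p q) ⟨
  suc p * (p + suc q) ! + suc q * (p + suc q) !
    ≡⟨ *-distribʳ-+ ((p + suc q) !) (suc p) (suc q) ⟨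
  (suc p + suc q) ! ∎
  where
  open ≡-Reasoning
  eq : ∀ a b p p! q q! → (a + b) * (p * p! * (q * q!)) ≡ p * (a * (p! * (q * q!))) + q * (b * (p * p! * q!))
  eq = solve-∀

paths-central-suc : ∀ m → suc m * paths (suc m) (suc m) ≡ 2 * suc (m + m) * paths m m
-- The multiplier (m + 1) m! m! turns both sides into (2m + 2)!.
paths-central-suc m = *-cancelʳ-≡ _ _ (suc m * (m ! * m !)) (begin
  suc m * paths (suc m) (suc m) * (suc m * (m ! * m !))   ≡⟨ eq (suc m) (paths (suc m) (suc m)) (m !) ⟩
  paths (suc m) (suc m) * (suc m ! * suc m !)             ≡⟨ paths-! (suc m) (suc m) ⟩
  (suc m + suc m) !                                       ≡⟨ cong (λ k → suc k !) (+-suc m m) ⟩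
  suc (suc (m + m)) * (suc (m + m) * (m + m) !)           ≡⟨ cong (λ x → suc (suc (m + m)) * (suc (m + m) * x)) (paths-! m m) ⟨
  suc (suc (m + m)) * (suc (m + m) * (paths m m * (m ! * m !))) ≡⟨ eq′ m (paths m m) (m !) ⟩
  2 * suc (m + m) * paths m m * (suc m * (m ! * m !))     ∎)
  where
  open ≡-Reasoning
  instance
    _ = m*n≢0 (suc m) (m ! * m !) {{_}} {{m !* m !≢0}}
  eq : ∀ k x f → k * x * (k * (f * f)) ≡ x * (k * f * (k * f))
  eq = solve-∀
  eq′ : ∀ m x f → suc (suc (m + m)) * (suc (m + m) * (x * (f * f))) ≡ 2 * suc (m + m) * x * (suc m * (f * f))
  eq′ = solve-∀

-- From m to m + 1 the right side grows by the factor 2 (2m + 3)/(m + 1), which is at least 4.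
4^≤paths : ∀ m → 4 ^ m ≤ suc (m + m) * paths m m
4^≤paths zero    = ≤-refl
4^≤paths (suc m) = *-cancelˡ-≤ (suc m) (begin
  suc m * (4 * 4 ^ m)                                   ≤⟨ *-monoʳ-≤ (suc m) (*-monoʳ-≤ 4 (4^≤paths m)) ⟩
  suc m * (4 * (suc (m + m) * paths m m))               ≡⟨ eq m (paths m m) ⟩
  suc (suc (m + m)) * (2 * suc (m + m) * paths m m)     ≤⟨ *-monoˡ-≤ (2 * suc (m + m) * paths m m) (n≤1+n (suc (suc (m + m)))) ⟩
  suc (suc (suc (m + m))) * (2 * suc (m + m) * paths m m) ≡⟨ cong₂ (λ k x → suc (suc k) * x) (sym (+-suc m m)) (sym (paths-central-suc m)) ⟩
  suc (suc m + suc m) * (suc m * paths (suc m) (suc m)) ≡⟨ eq′ (suc (suc m + suc m)) (suc m) (paths (suc m) (suc m)) ⟩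
  suc m * (suc (suc m + suc m) * paths (suc m) (suc m)) ∎)
  where
  open ≤-Reasoning
  eq : ∀ m x → suc m * (4 * (suc (m + m) * x)) ≡ suc (suc (m + m)) * (2 * suc (m + m) * x)
  eq = solve-∀
  eq′ : ∀ k l x → k * (l * x) ≡ l * (k * x)
  eq′ = solve-∀

-- Positions of the letters along a path.

-- The index of the r-th L (class false) or U (class true) in the word b LULU….
index : ∀ {p q} → Path p q → Bool → ℕ → ℕ
index []     false r       = 2 * r
index []     true  r       = suc (2 * r)
index (L∷ b) false zero    = 0
index (L∷ b) false (suc r) = suc (index b false r)
index (L∷ b) true  r       = suc (index b true r)
index (U∷ b) true  zero    = 0
index (U∷ b) true  (suc r) = suc (index b true r)
index (U∷ b) false r       = suc (index b false r)

index-mono : ∀ {p q} (b : Path p q) c {r r′} → r < r′ → index b c r < index b c r′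
index-mono []     false r<r′ = *-monoʳ-< 2 r<r′
index-mono []     true  r<r′ = s≤s (*-monoʳ-< 2 r<r′)
index-mono (L∷ b) false {zero}  {suc _} _          = z<s
index-mono (L∷ b) false {suc _} {suc _} (s≤s r<r′) = s≤s (index-mono b false r<r′)
index-mono (L∷ b) true  r<r′ = s≤s (index-mono b true r<r′)
index-mono (U∷ b) true  {zero}  {suc _} _          = z<s
index-mono (U∷ b) true  {suc _} {suc _} (s≤s r<r′) = s≤s (index-mono b true r<r′)
index-mono (U∷ b) false r<r′ = s≤s (index-mono b false r<r′)

index-class : ∀ {p q} (b : Path p q) {r r′} → index b false r ≢ index b true r′
index-class []     {r} {r′} eq = even≢odd r r′ eq
index-class (L∷ b) {suc r} eq = index-class b (suc-injective eq)
index-class (U∷ b) {_} {suc r′} eq = index-class b (suc-injective eq)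

index-rank : ∀ {p q} (b : Path p q) c {r r′} → index b c r ≡ index b c r′ → r ≡ r′
index-rank b c {r} {r′} eq with <-cmp r r′
... | tri< r<r′ _ _ = contradiction eq (<⇒≢ (index-mono b c r<r′))
... | tri≈ _ r≡r′ _ = r≡r′
... | tri> _ _ r′<r = contradiction (sym eq) (<⇒≢ (index-mono b c r′<r))

index-injective : ∀ {p q} (b : Path p q) c c′ {r r′} → index b c r ≡ index b c′ r′ → c ≡ c′ × r ≡ r′
index-injective b false true  eq = contradiction eq (index-class b)
index-injective b true  false eq = contradiction (sym eq) (index-class b)
index-injective b false false eq = refl , index-rank b false eq
index-injective b true  true  eq = refl , index-rank b true eq

-- The first r + 1 pairs of the alternating tail alone supply r + 1 letters of each class, so the
-- letter of rank r appears no later than there.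
index-< : ∀ {p q} (b : Path p q) c r → index b c r < p + q + 2 * suc r
index-< []     false r = *-monoʳ-< 2 (n<1+n r)
index-< []     true  r = ≤-reflexive (sym (*-suc 2 r))
index-< (L∷ b) false zero = z<s
index-< {suc p} {q} (L∷ b) false (suc r) = s≤s (<-≤-trans (index-< b false r)
  (+-monoʳ-≤ (p + q) (*-monoʳ-≤ 2 (n≤1+n (suc r)))))
index-< (L∷ b) true r = s≤s (index-< b true r)
index-< {p} {suc q} (U∷ b) true r rewrite +-suc p q with r
... | zero  = z<s
... | suc r = s≤s (<-≤-trans (index-< b true r) (+-monoʳ-≤ (p + q) (*-monoʳ-≤ 2 (n≤1+n (suc r)))))
index-< {p} {suc q} (U∷ b) false r rewrite +-suc p q = s≤s (index-< b false r)

-- If the first steps differ, the L and the U of rank 0 compare differently. If they agree, the step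
-- is removed and the ranks of its class shift by one.
index-recovers : ∀ {p q} (b b′ : Path p q) →
  (∀ {r r′} → r < p → r′ < q → (index b false r < index b true r′ → index b′ false r < index b′ true r′) ×
                               (index b true r′ < index b false r → index b′ true r′ < index b′ false r)) →
  b ≡ b′
index-recovers []     []      _ = refl
index-recovers (L∷ b) (L∷ b′) h = cong L∷_ (index-recovers b b′ λ r< r′< →
  let f , g = h (s≤s r<) r′< in s≤s⁻¹ ∘ f ∘ s≤s , s≤s⁻¹ ∘ g ∘ s≤s)
index-recovers (U∷ b) (U∷ b′) h = cong U∷_ (index-recovers b b′ λ r< r′< →
  let f , g = h r< (s≤s r′<) in s≤s⁻¹ ∘ f ∘ s≤s , s≤s⁻¹ ∘ g ∘ s≤s)
index-recovers (L∷ b) (U∷ b′) h with () ← proj₁ (h z<s z<s) z<s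
index-recovers (U∷ b) (L∷ b′) h with () ← proj₂ (h z<s z<s) z<s

-- Distribution of the half-teeth over the segments.

-- The first (false) or second (true) half of the tooth i is spread over the segment k,
-- as its increasing sequence L (false) or U (true); the last tooth has number S.
data At (S : ℕ) : ℕ → Bool → ℕ → Bool → Set where
  bottom :                       At S 0       false 0       false
  up     : ∀ {i} → suc i ≤ S →   At S (suc i) false i       true
  down   : ∀ {i} → i < S →       At S i       true  (suc i) false
  top    :                       At S S       true  S       true

-- Together with `at⁻¹`, `At-injective` and `At-functional` this makes `At` a bijection between
-- halves of teeth and pairs of a segment and a class.
at : ∀ {S} i h → i ≤ S → ∃₂ λ k c → At S i h k c
at zero    false _ = _ , _ , bottom
at (suc i) false i<S = _ , _ , up i<S
at i       true  i≤S with m≤n⇒m<n∨m≡n i≤S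
... | inj₁ i<S  = _ , _ , down i<S
... | inj₂ refl = _ , _ , top

at⁻¹ : ∀ {S} k c → k ≤ S → ∃₂ λ i h → i ≤ S × At S i h k c
at⁻¹ zero    false _ = _ , _ , z≤n , bottom
at⁻¹ (suc k) false k<S = _ , _ , <⇒≤ k<S , down k<S
at⁻¹ k       true  k≤S with m≤n⇒m<n∨m≡n k≤S
... | inj₁ k<S  = _ , _ , k<S , up k<S
... | inj₂ refl = _ , _ , ≤-refl , top

At-injective : ∀ {S i h i′ h′ k c} → At S i h k c → At S i′ h′ k c → i ≡ i′ × h ≡ h′
At-injective bottom   bottom   = refl , refl
At-injective (up _)   (up _)   = refl , refl
At-injective (up i<i) top      = contradiction i<i (<-irrefl refl)
At-injective (down _) (down _) = refl , refl
At-injective top      (up i<i) = contradiction i<i (<-irrefl refl)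
At-injective top      top      = refl , refl

At-functional : ∀ {S i h k c k′ c′} → At S i h k c → At S i h k′ c′ → k ≡ k′ × c ≡ c′
At-functional bottom     bottom     = refl , refl
At-functional (up _)     (up _)     = refl , refl
At-functional (down _)   (down _)   = refl , refl
At-functional (down i<i) top        = contradiction i<i (<-irrefl refl)
At-functional top        (down i<i) = contradiction i<i (<-irrefl refl)
At-functional top        top        = refl , refl

-- L runs through the first half of tooth 0 and then the second halves of all teeth but the last. U
-- runs through the first halves of the other teeth and then the second half of the last. Both
-- advance with the tooth.
At-class : ∀ {S i h k i′ h′ k′ c} → At S i h k c → At S i′ h′ k′ c → i < i′ → k < k′
At-class bottom     (down _)   _         = z<s
At-class (up _)     (up _)     (s≤s i<j) = i<j
At-class (up i<S)   top        _         = i<S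
At-class (down _)   (down _)   i<j       = s≤s i<j
At-class top        (up j<S)   S<1+j     = contradiction S<1+j (≤⇒≯ j<S)
At-class top        top        S<S       = contradiction S<S (<-irrefl refl)

-- With a single tooth both halves would share segment 0, hence 0 < S.
At-halves : ∀ {S i k c k′ c′} → 0 < S → At S i false k c → At S i true k′ c′ → k < k′
At-halves _   bottom   (down _) = z<s
At-halves 0<S bottom   top      = 0<S
At-halves _   (up _)   (down _) = <-trans (n<1+n _) (n<1+n _)
At-halves _   (up _)   top      = n<1+n _

-- The first halves of teeth 0 and 1 share segment 0. This is the one spine cover that the segments
-- leave open; the initial L of segment 0 settles it.
At-spine : ∀ {S i k c k′ c′} → At S i false k c → At S (suc i) false k′ c′ →
           k < k′ ⊎ (k ≡ 0 × c ≡ false × k′ ≡ 0 × c′ ≡ true)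
At-spine bottom (up _) = inj₂ (refl , refl , refl , refl)
At-spine (up _) (up _) = inj₁ (n<1+n _)

-- Keys ordering the comb by segment, then by place within the segment.

lex-< : ∀ {B k k′ x} y → k < k′ → x < B → k * B + x < k′ * B + y
lex-< {B} {k} {k′} {x} y k<k′ x<B = begin-strict
  k * B + x     <⟨ +-monoʳ-< (k * B) x<B ⟩
  k * B + B     ≡⟨ +-comm (k * B) B ⟩
  suc k * B     ≤⟨ *-monoˡ-≤ B k<k′ ⟩
  k′ * B        ≤⟨ m≤m+n (k′ * B) y ⟩
  k′ * B + y    ∎
  where open ≤-Reasoning

lex-injective : ∀ {B} k k′ {x y} → x < B → y < B → k * B + x ≡ k′ * B + y → k ≡ k′ × x ≡ y
lex-injective {B} k k′ {x} {y} x<B y<B eq with <-cmp k k′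
... | tri< k<k′ _ _ = contradiction eq (<⇒≢ (lex-< y k<k′ x<B))
... | tri≈ _ refl _ = refl , +-cancelˡ-≡ (k * B) x y eq
... | tri> _ _ k′<k = contradiction (sym eq) (<⇒≢ (lex-< x k′<k y<B))

combine-<⁻ : ∀ {s t} (i i′ : Fin s) (j j′ : Fin t) → combine i j Fin.< combine i′ j′ →
             i Fin.< i′ ⊎ (i ≡ i′ × j Fin.< j′)
combine-<⁻ {t = t} i i′ j j′ lt with Fin.<-cmp i i′
... | tri< i<i′ _ _ = inj₁ i<i′
... | tri≈ _ refl _ = inj₂ (refl , +-cancelˡ-< (t * toℕ i) _ _ (subst₂ _<_ (Fin.toℕ-combine i j) (Fin.toℕ-combine i j′) lt))
... | tri> _ _ i′<i = contradiction lt (<-asym (Fin.combine-monoˡ-< j′ j i′<i))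

-- A path in `Path m m` steers each segment. First halves have m + 1 elements and second halves n ≥
-- m, so each sequence fills its share of the path; what is left over follows the alternating tail.
module Shuffle (S m n : ℕ) (0<S : 0 < S) (m≤n : m ≤ n) where

  private
    s t B : ℕ
    s = suc S
    t = suc m + n
    -- Exceeds every index in a segment: its path has at most 2m + 1 steps, and ranks are below t.
    B = suc (m + m) + 2 * t

  size : Bool → ℕ
  size false = suc m
  size true  = n

  offset : Bool → ℕ
  offset false = 0
  offset true  = suc m

  half : Fin t → Bool × ℕ
  half j = [ (λ r → false , toℕ r) , (λ r → true , toℕ r) ]′ (splitAt (suc m) {n} j)

  half-toℕ : ∀ j → toℕ j ≡ offset (proj₁ (half j)) + proj₂ (half j)
  half-toℕ j with splitAt (suc m) {n} j in eq
  ... | inj₁ r = trans (cong toℕ (sym (Fin.splitAt⁻¹-↑ˡ {suc m} eq))) (Fin.toℕ-↑ˡ r n)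
  ... | inj₂ r = trans (cong toℕ (sym (Fin.splitAt⁻¹-↑ʳ {suc m} {n} {j} eq))) (Fin.toℕ-↑ʳ (suc m) r)

  half-size : ∀ j → proj₂ (half j) < size (proj₁ (half j))
  half-size j with splitAt (suc m) {n} j
  ... | inj₁ r = Fin.toℕ<n r
  ... | inj₂ r = Fin.toℕ<n r

  half-injective : ∀ j j′ → proj₁ (half j) ≡ proj₁ (half j′) → proj₂ (half j) ≡ proj₂ (half j′) → j ≡ j′
  half-injective j j′ h≡ r≡ = Fin.toℕ-injective
    (trans (half-toℕ j) (trans (cong₂ (λ h r → offset h + r) h≡ r≡) (sym (half-toℕ j′))))

  half⁻¹ : ∀ h {r} → r < size h → ∃ λ j → half j ≡ (h , r)
  half⁻¹ false r<m = fromℕ< r<m Fin.↑ˡ n ,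
    trans (cong [ _ , _ ]′ (Fin.splitAt-↑ˡ (suc m) (fromℕ< r<m) n)) (cong (false ,_) (Fin.toℕ-fromℕ< r<m))
  half⁻¹ true  r<n = suc m Fin.↑ʳ fromℕ< r<n ,
    trans (cong [ _ , _ ]′ (Fin.splitAt-↑ʳ (suc m) n (fromℕ< r<n))) (cong (true ,_) (Fin.toℕ-fromℕ< r<n))

  size≤t : ∀ h → size h ≤ t
  size≤t false = m≤m+n (suc m) n
  size≤t true  = m≤n+m n (suc m)

  private
    compare-halves : ∀ h h′ {r r′} → r′ < size h′ → offset h + r < offset h′ + r′ →
                     (h ≡ h′ × r < r′) ⊎ (h ≡ false × h′ ≡ true)
    compare-halves false false _ lt = inj₁ (refl , lt)
    compare-halves false true  _ _  = inj₂ (refl , refl)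
    compare-halves true  true  _ lt = inj₁ (refl , +-cancelˡ-< (suc m) _ _ lt)
    compare-halves true  false {r} r′<size lt = contradiction lt (<-asym (<-≤-trans r′<size (m≤m+n (suc m) r)))

  segSize : ℕ → ℕ
  segSize zero    = suc m
  segSize (suc _) = m

  -- Segment 0 opens with the least element of the comb.
  segPath : ∀ k → Path m m → Path (segSize k) m
  segPath zero    b = L∷ b
  segPath (suc _) b = b

  segPath-injective : ∀ k {b b′} → segPath k b ≡ segPath k b′ → b ≡ b′
  segPath-injective zero    = L∷-injective
  segPath-injective (suc _) = id

  segPath-< : ∀ k b c {r} → r < t → index (segPath k b) c r < B
  segPath-< k b c {r} r<t = <-≤-trans (index-< (segPath k b) c r) (+-mono-≤ (+-monoˡ-≤ m (segSize≤ k)) (*-monoʳ-≤ 2 r<t))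
    where
    segSize≤ : ∀ k → segSize k ≤ suc m
    segSize≤ zero    = ≤-refl
    segSize≤ (suc _) = n≤1+n m

  placeKey : (ℕ → Path m m) → ℕ → Bool → ℕ → ℕ
  placeKey b k c r = k * B + index (segPath k (b k)) c r

  rank : Fin s × Fin t → ℕ
  rank (i , j) = proj₂ (half j)

  place : ∀ ((i , j) : Fin s × Fin t) → ∃₂ λ k c → At S (toℕ i) (proj₁ (half j)) k c
  place (i , j) = at (toℕ i) (proj₁ (half j)) (s≤s⁻¹ (Fin.toℕ<n i))

  seg : Fin s × Fin t → ℕ
  seg = proj₁ ∘ place

  class : Fin s × Fin t → Bool
  class = proj₁ ∘ proj₂ ∘ place

  At-place : ∀ ((i , j) : Fin s × Fin t) → At S (toℕ i) (proj₁ (half j)) (seg (i , j)) (class (i , j))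
  At-place = proj₂ ∘ proj₂ ∘ place

  key : (ℕ → Path m m) → Fin s × Fin t → ℕ
  key b x = placeKey b (seg x) (class x) (rank x)

  rank<t : ∀ x → rank x < t
  rank<t (_ , j) = <-≤-trans (half-size j) (size≤t _)

  module _ (b : ℕ → Path m m) where

    placeKey-injective : ∀ {k c r k′ c′ r′} → r < t → r′ < t → placeKey b k c r ≡ placeKey b k′ c′ r′ →
                         k ≡ k′ × c ≡ c′ × r ≡ r′
    placeKey-injective {k} {c} {r} {k′} {c′} r<t r′<t eq
      with refl , eq′ ← lex-injective k k′ (segPath-< k (b k) c r<t) (segPath-< k′ (b k′) c′ r′<t) eq
      = refl , index-injective (segPath k (b k)) c c′ eq′

    key-injective : ∀ x y → key b x ≡ key b y → x ≡ y
    key-injective x@(i , j) y@(i′ , j′) eq =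
      let k≡ , c≡ , r≡ = placeKey-injective {seg x} {class x} {_} {seg y} {class y} (rank<t x) (rank<t y) eq
          i≡ , h≡ = At-injective (subst₂ (At S _ _) k≡ c≡ (At-place x)) (At-place y)
      in cong₂ _,_ (Fin.toℕ-injective i≡) (half-injective j j′ h≡ r≡)

    seg-mono : ∀ {x y} → seg x < seg y → key b x < key b y
    seg-mono {x} {y} lt = lex-< (index (segPath (seg y) (b (seg y))) (class y) (rank y)) lt
      (segPath-< (seg x) (b (seg x)) (class x) (rank<t x))

    rank-mono : ∀ {x y} → seg x ≡ seg y → class x ≡ class y → rank x < rank y → key b x < key b y
    rank-mono {x} {y} k≡ c≡ lt = subst₂ (λ k c → key b x < placeKey b k c (rank y)) k≡ c≡
      (+-monoʳ-< (seg x * B) (index-mono (segPath (seg x) (b (seg x))) (class x) lt))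

    -- Within a half the rank decides, between the halves the segment.
    key-tooth : ∀ i {j j′} → j Fin.< j′ → key b (i , j) < key b (i , j′)
    key-tooth i {j} {j′} j<j′ with compare-halves (proj₁ (half j)) (proj₁ (half j′)) (half-size j′)
                                     (subst₂ _<_ (half-toℕ j) (half-toℕ j′) j<j′)
    ... | inj₁ (h≡ , r<) = let k≡ , c≡ = At-functional (subst (λ h → At S (toℕ i) h (seg (i , j)) (class (i , j))) h≡ (At-place (i , j))) (At-place (i , j′))
                           in rank-mono {i , j} {i , j′} k≡ c≡ r<
    ... | inj₂ (h≡ , h′≡) = seg-mono {i , j} {i , j′} (At-halves 0<S
      (subst (λ h → At S (toℕ i) h (seg (i , j)) (class (i , j))) h≡ (At-place (i , j))) (subst (λ h → At S (toℕ i) h (seg (i , j′)) (class (i , j′))) h′≡ (At-place (i , j′))))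

    key-class : ∀ {i i′ j j′} → class (i , j) ≡ class (i′ , j′) → i Fin.< i′ → key b (i , j) < key b (i′ , j′)
    key-class {i} {i′} {j} {j′} c≡ i<i′ = seg-mono {i , j} {i′ , j′}
      (At-class (subst (At S _ _ _) c≡ (At-place (i , j))) (At-place (i′ , j′)) i<i′)

    key-spine : ∀ {i i′ j} → toℕ j ≡ 0 → toℕ i′ ≡ suc (toℕ i) → key b (i , j) < key b (i′ , j)
    key-spine {i} {i′} {zero} _ i′≡1+i
      with At-spine (At-place (i , zero)) (subst (λ i → At S i false (seg (i′ , zero)) (class (i′ , zero))) i′≡1+i (At-place (i′ , zero)))
    ... | inj₁ lt = seg-mono {i , zero} {i′ , zero} lt
    -- As segment 0 opens with L, the least element gets key 0 and every U there a positive key.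
    ... | inj₂ (k≡0 , c≡L , k′≡0 , c′≡U) = subst₂ _<_
      (sym (cong₂ (λ k c → placeKey b k c 0) k≡0 c≡L)) (sym (cong₂ (λ k c → placeKey b k c 0) k′≡0 c′≡U)) z<s

    -- The monotonicity that `word-avoids` asks for: segments give it across teeth, the tooth order
    -- within one.
    key-label : ∀ x y → class x ≡ class y → label x Fin.< label y → key b x < key b y
    key-label (i , j) (i′ , j′) c≡ lt with combine-<⁻ i i′ j j′ lt
    ... | inj₁ i<i′          = key-class {i} {i′} {j} {j′} c≡ i<i′
    ... | inj₂ (refl , j<j′) = key-tooth i {j} {j′} j<j′

    key-⋖ : ∀ {x y} → x ⋖ y → key b x < key b y
    key-⋖ (spine j≡0 i′≡1+i) = key-spine j≡0 i′≡1+i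
    key-⋖ (tooth {i} {j} {j′} j′≡1+j) = key-tooth i {j} {j′} (≤-reflexive (sym j′≡1+j))

    key-Comb : ∀ {x y} → Comb x y → key b x ≤ key b y
    key-Comb ε       = ≤-refl
    key-Comb (c ◅ r) = ≤-trans (<⇒≤ (key-⋖ c)) (key-Comb r)

    private
      unlabel′ : Fin (s * t) → Fin s × Fin t
      unlabel′ = remQuot {s} t

    open Sorting (key b ∘ unlabel′) (λ {x} {y} eq → trans (sym (Fin.combine-remQuot {s} t x))
      (trans (cong (uncurry combine) (key-injective (unlabel′ x) (unlabel′ y) eq)) (Fin.combine-remQuot {s} t y))) public

    word-valid : IsLinearExtension (Kᵝ s t) word × Avoids321 word
    word-valid = word-extends (Kᵝ s t) key-Comb , word-avoids (class ∘ unlabel′) class-mono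
      where
      class-mono : ∀ {x y} → class (unlabel′ x) ≡ class (unlabel′ y) → x Fin.< y →
                   key b (unlabel′ x) < key b (unlabel′ y)
      class-mono {x} {y} c≡ x<y = key-label (unlabel′ x) (unlabel′ y) c≡ (subst₂ Fin._<_
        (sym (Fin.combine-remQuot {s} t x)) (sym (Fin.combine-remQuot {s} t y)) x<y)

  private
    r<size : ∀ k c {i h r} → r < (if c then m else segSize k) → At S i h k c → r < size h
    r<size _       true  r<m (up _)   = m<n⇒m<1+n r<m
    r<size _       true  r<m top      = <-≤-trans r<m m≤n
    r<size zero    false r<  bottom   = r<
    r<size (suc _) false r<m (down _) = <-≤-trans r<m m≤n

    -- The halves are long enough for all ranks on the path, by `r<size`. One x serves every b, so
    -- two words can be compared on the same letters.
    elementAt : ∀ k c {r} → k ≤ S → r < (if c then m else segSize k) →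
                ∃ λ x → ∀ b → key b (unlabel {s} {t} x) ≡ placeKey b k c r
    elementAt k c {r} k≤S r< with i , h , i≤S , At₀ ← at⁻¹ k c k≤S
      with j , half≡ ← half⁻¹ h (r<size k c r< At₀) = label (i′ , j) , λ b → begin
        key b (unlabel (label (i′ , j)))                        ≡⟨ cong (key b) (Fin.remQuot-combine i′ j) ⟩
        placeKey b (seg (i′ , j)) (class (i′ , j)) (rank (i′ , j)) ≡⟨ cong₂ (λ k c → placeKey b k c (rank (i′ , j))) (proj₁ kc≡) (proj₂ kc≡) ⟩
        placeKey b k c (rank (i′ , j))                          ≡⟨ cong (placeKey b k c ∘ proj₂) half≡ ⟩
        placeKey b k c r                                        ∎
      where
      open ≡-Reasoning
      i′ = fromℕ< (s≤s i≤S)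
      kc≡ : seg (i′ , j) ≡ k × class (i′ , j) ≡ c
      kc≡ = At-functional (subst₂ (λ i h → At S i h (seg (i′ , j)) (class (i′ , j))) (Fin.toℕ-fromℕ< (s≤s i≤S)) (cong proj₁ half≡)
        (At-place (i′ , j))) At₀

  -- Equal words order the letters of segment k alike. Inside the segment this is the comparison of
  -- indices, from which the path is recovered.
  word-recovers : ∀ b b′ → word b ≡ word b′ → ∀ k → k ≤ S → b k ≡ b′ k
  word-recovers b b′ w≡ k k≤S = segPath-injective k (index-recovers (segPath k (b k)) (segPath k (b′ k)) λ r< r′< →
    let x , x≡ = elementAt k false k≤S r<
        y , y≡ = elementAt k true k≤S r′<
    in transfer x y (x≡ b) (y≡ b) (x≡ b′) (y≡ b′) , transfer y x (y≡ b) (x≡ b) (y≡ b′) (x≡ b′))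
    where
    transfer : ∀ x y {o o′ p p′} →
      key b (unlabel {s} {t} x) ≡ k * B + o → key b (unlabel {s} {t} y) ≡ k * B + o′ →
      key b′ (unlabel {s} {t} x) ≡ k * B + p → key b′ (unlabel {s} {t} y) ≡ k * B + p′ → o < o′ → p < p′
    transfer x y x≡ y≡ x′≡ y′≡ o<o′ = +-cancelˡ-< (k * B) _ _ (subst₂ _<_ x′≡ y′≡
      (word-precedes⁻ b′ x y (subst (λ w → Precedes w x y) w≡
        (word-precedes b x y (subst₂ _<_ (sym x≡) (sym y≡) (+-monoʳ-< (k * B) o<o′))))))

-- Lower bound: counting the shuffles.

finToFun-injective : ∀ {n m} {x y : Fin (n ^ m)} → (∀ i → finToFun {n} {m} x i ≡ finToFun y i) → x ≡ y
finToFun-injective {n} {m} {x} {y} eq = trans (sym (Fin.funToFin-finToFin {m} {n} x))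
    (trans (funToFin-cong eq) (Fin.funToFin-finToFin {m} {n} y))
  where
  funToFin-cong : ∀ {m n} {f g : Fin m → Fin n} → (∀ i → f i ≡ g i) → funToFin f ≡ funToFin g
  funToFin-cong {zero}  eq = refl
  funToFin-cong {suc m} eq = cong₂ combine (eq zero) (funToFin-cong (eq ∘ suc))

paths^≤A₃₂₁ : ∀ S m n → 0 < S → m ≤ n → paths m m ^ suc S ≤ A₃₂₁ (Kᵝ (suc S) (suc m + n))
paths^≤A₃₂₁ S m n 0<S m≤n = ≤length-filter _ _ words-complete (word ∘ choice) (word-valid ∘ choice) λ {x} {y} eq →
  finToFun-injective {paths m m} {suc S} λ i → decode-injective m m (subst
    (λ i → decode m m (finToFun {paths m m} {suc S} x i) ≡ decode m m (finToFun {paths m m} {suc S} y i)) (clamp-toℕ i)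
    (word-recovers (choice x) (choice y) eq (toℕ i) (s≤s⁻¹ (Fin.toℕ<n i))))
  where
  open Shuffle S m n 0<S m≤n
  -- `Shuffle` expects a path for every natural number, so numbers above S are cut down to S.
  clamp : ℕ → Fin (suc S)
  clamp k = fromℕ< (s≤s (m⊓n≤n k S))
  clamp-toℕ : ∀ i → clamp (toℕ i) ≡ i
  clamp-toℕ i = Fin.toℕ-injective (trans (Fin.toℕ-fromℕ< _) (m≤n⇒m⊓n≡m (s≤s⁻¹ (Fin.toℕ<n i))))
  choice : Fin (paths m m ^ suc S) → ℕ → Path m m
  choice x k = decode m m (finToFun x (clamp k))

-- The length m + 1 + n is at most 2m + 2, which gives 4 · 4^m, and at least 2m + 1, the factor lost
-- in `4^≤paths`.
2^≤paths : ∀ m n → n ≤ suc m → m ≤ n → 2 ^ (suc m + n) ≤ 4 * (suc m + n) * paths m m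
2^≤paths m n n≤1+m m≤n = begin
  2 ^ (suc m + n)                     ≤⟨ ^-monoʳ-≤ 2 (+-monoʳ-≤ (suc m) n≤1+m) ⟩
  2 ^ (suc m + suc m)                 ≡⟨ cong (λ k → 2 ^ (suc m + k)) (+-identityʳ (suc m)) ⟨
  2 ^ (2 * suc m)                     ≡⟨ ^-*-assoc 2 2 (suc m) ⟨
  4 * 4 ^ m                           ≤⟨ *-monoʳ-≤ 4 (4^≤paths m) ⟩
  4 * (suc (m + m) * paths m m)       ≤⟨ *-monoʳ-≤ 4 (*-monoˡ-≤ (paths m m) (+-monoʳ-≤ (suc m) m≤n)) ⟩
  4 * ((suc m + n) * paths m m)       ≡⟨ *-assoc 4 (suc m + n) (paths m m) ⟨
  4 * (suc m + n) * paths m m         ∎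
  where open ≤-Reasoning

2^≤A₃₂₁-split : ∀ S m n → 0 < S → m ≤ n → n ≤ suc m →
  2 ^ (suc S * (suc m + n)) ≤ (4 * (suc m + n)) ^ suc S * A₃₂₁ (Kᵝ (suc S) (suc m + n))
2^≤A₃₂₁-split S m n 0<S m≤n n≤1+m = begin
  2 ^ (suc S * (suc m + n))                        ≡⟨ cong (2 ^_) (*-comm (suc S) (suc m + n)) ⟩
  2 ^ ((suc m + n) * suc S)                        ≡⟨ ^-*-assoc 2 (suc m + n) (suc S) ⟨
  (2 ^ (suc m + n)) ^ suc S                        ≤⟨ ^-monoˡ-≤ (suc S) (2^≤paths m n n≤1+m m≤n) ⟩
  (4 * (suc m + n) * paths m m) ^ suc S            ≡⟨ ^-distribʳ-* (4 * (suc m + n)) (paths m m) (suc S) ⟩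
  (4 * (suc m + n)) ^ suc S * paths m m ^ suc S    ≤⟨ *-monoʳ-≤ ((4 * (suc m + n)) ^ suc S) (paths^≤A₃₂₁ S m n 0<S m≤n) ⟩
  (4 * (suc m + n)) ^ suc S * A₃₂₁ (Kᵝ (suc S) (suc m + n)) ∎
  where open ≤-Reasoning

2^≤A₃₂₁ : ∀ s t .{{_ : NonZero t}} → 2 ≤ s → 2 ^ (s * t) ≤ (4 * t) ^ s * A₃₂₁ (Kᵝ s t)
2^≤A₃₂₁ (suc S) (suc t) (s≤s 0<S) = subst
  (λ t → 2 ^ (suc S * suc t) ≤ (4 * suc t) ^ suc S * A₃₂₁ (Kᵝ (suc S) (suc t))) (⌊n/2⌋+⌈n/2⌉≡n t)
  -- Here `t` is one less than the length of a tooth; its floor and ceiling halves satisfy m ≤ n ≤ m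
  -- + 1.
  (2^≤A₃₂₁-split S ⌊ t /2⌋ ⌈ t /2⌉ 0<S (⌊n/2⌋≤⌈n/2⌉ t) (⌊n/2⌋-mono (n≤1+n (suc t))))

theorem6 : ∀ (s : ℕ) → 2 ≤ s → (λ t → root t (A₃₂₁ (Kᵝ s t))) ⟶ fromℚ (fromℕ (2 ^ s))
-- Both bounds lose a factor (4 t)^s, hence K = 4^s; for the upper one, t + 1 ≤ 4 t as t ≥ 1.
theorem6 s 2≤s = root-limit (λ t → A₃₂₁ (Kᵝ s t)) (2 ^ s) (4 ^ s) s {{m^n≢0 2 s}}
  (λ t → begin
    A₃₂₁ (Kᵝ s t)                ≤⟨ A₃₂₁-Kᵝ≤ s t ⟩
    2 ^ (s * t) * suc t ^ s      ≤⟨ *-monoʳ-≤ (2 ^ (s * t)) (^-monoˡ-≤ s (1+t≤4t t)) ⟩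
    2 ^ (s * t) * (4 * t) ^ s    ≡⟨ *-comm (2 ^ (s * t)) ((4 * t) ^ s) ⟩
    (4 * t) ^ s * 2 ^ (s * t)    ≡⟨ cong₂ _*_ (^-distribʳ-* 4 t s) (sym (^-*-assoc 2 s t)) ⟩
    4 ^ s * t ^ s * (2 ^ s) ^ t  ∎)
  (λ t → begin
    (2 ^ s) ^ t                     ≡⟨ ^-*-assoc 2 s t ⟩
    2 ^ (s * t)                     ≤⟨ 2^≤A₃₂₁ s t 2≤s ⟩
    (4 * t) ^ s * A₃₂₁ (Kᵝ s t)     ≡⟨ cong (_* A₃₂₁ (Kᵝ s t)) (^-distribʳ-* 4 t s) ⟩
    4 ^ s * t ^ s * A₃₂₁ (Kᵝ s t)   ∎)
  where
  open ≤-Reasoning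
  1+t≤4t : ∀ t .{{_ : NonZero t}} → suc t ≤ 4 * t
  1+t≤4t (suc t) = subst (_≤ 4 * suc t) (+-comm (suc t) 1) (+-monoʳ-≤ (suc t) (s≤s {n = t + 2 * suc t} z≤n))
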